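{- Let $p$ be a prime. The reduced sets for Algorithms A, B and C (the set of elements having purely periodic expansions by the respective algorithm) are given by $S$, $R$, and $P_1\cup R_1\cup S_3\cup S_4$, respectively.
   Context: Let $p$ be a prime, $v_p$ the $p$-adic additive valuation and $|\alpha|_p = p^{ -v_p(\alpha)}$. Each $\alpha\in\mathbb{Q}_p$ has a unique $p$-adic expansion $\alpha=\sum_{i} e_i p^i$ with $e_i\in\{0,1,\dots,p-1\}$ and $e_i\ne 0$ for at most finitely many $i\le 0$; put $[\alpha]=\sum_{i\le 0} e_i p^i$ and $\langle\alpha\rangle=\sum_{i\ge 1}e_ip^i$, so $\alpha=[\alpha]+\langle\alpha\rangle$. Let $A_p$ be the set of elements of $p\mathbb{Z}_p$ that are algebraic over $\mathbb{Q}$ of degree at most two. The minimal polynomial of an algebraic element is its integral polynomial of lowest degree with positive leading coefficient and coprime coefficients. For $x\in A_p$ write it as $aX^2+bX+c$ if $x$ is quadratic and as $bX+c$ if $x$ is rational. For $x\in A_p\setminus\{0\}$ put $u(x)=c|c|_p\in\mathbb{Z}\setminus p\mathbb{Z}$, and define maps $T_1,T_2:A_p\setminus\{0\}\to A_p$ by $$T_1(x)=\frac{u(x)p^{v_p(x)}}{x}-d_1(x),\qquad T_2(x)=\frac{ -u(x)p^{v_p(x)}}{x}-d_2(x),$$ where $d_1(x),d_2(x)\in\{1,\dots,p-1\}$ are the unique choices making $T_1(x),T_2(x)\in p\mathbb{Z}_p$. The three algorithms are given by the following maps $T:A_p\setminus\{0\}\to A_p$ (where the minimal polynomial of $x$ is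 $aX^2+bX+c$ if $x$ is quadratic and $bX+c$ if $x$ is rational). Algorithm A: $T(x)=T_2(x)$. Algorithm B: $T(x)=T_2(x)$ if $b\ge 0$, and $T(x)=T_1(x)$ if $b<0$. Algorithm C: $T(x)=T_2(x)$ if $b\ge 0$ and $c>0$, and $T(x)=T_1(x)$ otherwise. For a given algorithm put $t(x)=u(x)$, $d(x)=d_1(x)$ when $T(x)$ is defined as $T_1(x)$, and $t(x)=-u(x)$, $d(x)=d_2(x)$ when $T(x)$ is defined as $T_2(x)$; thus $T(x)=t(x)p^{v_p(x)}/x-d(x)$. The expansion of $\alpha\in\mathbb{Q}_p$ (algebraic of degree at most two) by the algorithm is the continued fraction $$[\alpha]+\cfrac{t_1p^{k_1}}{d_1+\cfrac{t_2p^{k_2}}{d_2+\cfrac{t_3p^{k_3}}{\ddots}}},\qquad t_i=t(T^{i-1}(\langle\alpha\rangle)),\ k_i=v_p(T^{i-1}(\langle\alpha\rangle)),\ d_i=d(T^{i-1}(\langle\alpha\rangle)),$$ which terminates after the $N$-th term if $T^N(\langle\alpha\rangle)=0$ for some (first) $N\ge 0$, and is infinite otherwise. The expansion is purely periodic if it is infinite, $[\alpha]=0$ (so $\alpha\in p\mathbb{Z}_p$), and there is $\ell\ge1$ with $(t_{i+\ell},k_{i+\ell},d_{i+\ell})=(t_i,k_i,d_i)$ for all $i\ge 1$. The reduced set for an algorithm is the set of all elements $\alpha$ having a purely periodic expansion by that algorithm. A quadratic Hensel root is an element of $p\mathbb{Z}_p$ that is a root of an irreducible polynomial $X^2+bX+c\in\mathbb{Z}[X]$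 with $b\in\mathbb{Z}\setminus p\mathbb{Z}$ and $c\in p\mathbb{Z}$. By Hensel's Lemma such a polynomial has exactly one root in $p\mathbb{Z}_p$, and the root is identified with the pair $(b,c)$. Under this identification: $S=\{(b,c)\in\mathbb{Z}^2 : b\in\mathbb{Z}\setminus p\mathbb{Z},\ c\in p\mathbb{Z},\ X^2+bX+c \text{ irreducible}\}$ is the set of all quadratic Hensel roots; $S_1=\{(b,c)\in S: b>0,\ c>0\}$, $S_3=\{(b,c)\in S: b<0,\ c<0\}$, $S_4=\{(b,c)\in S: b>0,\ c<0\}$; $R=\{(b,c)\in S: 1\le b\le p-1\}$, $R_1=\{(b,c)\in S_1: 1\le b\le p-1\}$; $P_1=\{(b,c)\in S_1\setminus R_1 : c<[b]\langle b\rangle\}$, where $[b]=\sum_{i\le 0} e_i p^i$ and $\langle b\rangle=\sum_{i\ge 1} e_i p^i$ are the integral and fractional parts of $b$, with $b=\sum_i e_i p^i$ the $p$-adic expansion of $b$ (for a positive integer $b$ prime to $p$, $[b]\in\{1,\dots,p-1\}$ is the residue of $b$ mod $p$ and $\langle b\rangle=b-[b]$). -}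

module Defs where

open import Algebra.Bundles using (RawSemiring)
import Algebra.Definitions.RawSemiring as RawSemiringDefinitions
open import Data.Bool.Base using (if_then_else_; _∧_)
open import Data.Integer.Base
  using (ℤ; +_; -_; _+_; _-_; _*_; _≤_; _<_; 0ℤ; 1ℤ)
open import Data.Integer.DivMod using (_%ℕ_)
open import Data.Integer.Divisibility.Signed
  using (_∣_; divides; ∣m∣n⇒∣m+n; ∣m⇒∣m*n; ∣n⇒∣m*n)
open import Data.Integer.Properties using (_≤?_; _<?_; +-inverseʳ)
import Data.Integer.Tactic.RingSolver as ℤ-Solver
open import Data.List.Base using (List; []; _∷_; length; map)
open import Data.List.Relation.Unary.All using (All)
open import Data.Nat.Base as ℕ using (ℕ; zero; suc; NonZero)
import Data.Nat.DivMod as ℕ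
open import Data.Nat.Primality using (Prime; prime⇒nonZero)
open import Data.Nat.Properties using (m^n≢0)
open import Data.Product.Base using (Σ-syntax; ∃-syntax; _×_; _,_)
open import Level using (0ℓ)
open import Relation.Binary.PropositionalEquality.Core
  using (_≡_; subst)
open import Relation.Nullary using (¬_; does)
open import Relation.Unary using (Pred)

-- The head of a list is the constant coefficient.  Trailing zeros are allowed,
-- so equality of polynomials compares coefficients.

ℤ[X] : Set
ℤ[X] = List ℤ

coeff : ℤ[X] → ℕ → ℤ
coeff []      _       = 0ℤ
coeff (a ∷ f) zero    = a
coeff (a ∷ f) (suc n) = coeff f n

infix 4 _≈ᴾ_

_≈ᴾ_ : ℤ[X] → ℤ[X] → Set
f ≈ᴾ g = ∀ n → coeff f n ≡ coeff g n

_+ᴾ_ : ℤ[X] → ℤ[X] → ℤ[X]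
[]      +ᴾ g       = g
(a ∷ f) +ᴾ []      = a ∷ f
(a ∷ f) +ᴾ (b ∷ g) = (a + b) ∷ (f +ᴾ g)

_*ᴾ_ : ℤ[X] → ℤ[X] → ℤ[X]
[]      *ᴾ g = []
(a ∷ f) *ᴾ g = map (a *_) g +ᴾ (0ℤ ∷ (f *ᴾ g))

ℤ[X]-rawSemiring : RawSemiring 0ℓ 0ℓ
ℤ[X]-rawSemiring = record
  { Carrier = ℤ[X]
  ; _≈_     = _≈ᴾ_
  ; _+_     = _+ᴾ_
  ; _*_     = _*ᴾ_
  ; 0#      = []
  ; 1#      = 1ℤ ∷ []
  }

open RawSemiringDefinitions ℤ[X]-rawSemiring public using (Irreducible)

data Algorithm : Set where
  A B C : Algorithm

data Branch : Set where
  T₁ T₂ : Branch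

-- The branch taken at an element whose minimal polynomial has linear
-- coefficient b and constant coefficient c.

branch : Algorithm → (b c : ℤ) → Branch
branch A b c = T₂
branch B b c = if does (0ℤ ≤? b) then T₂ else T₁
branch C b c = if does (0ℤ ≤? b) ∧ does (0ℤ <? c) then T₂ else T₁

signed : Branch → ℤ → ℤ
signed T₁ u = u
signed T₂ u = - u

-- Candidate minimal polynomials aX² + bX + c of quadratic and bX + c of
-- rational elements; the linear coefficient is called b in both cases.

data Coefficients : Set where
  quadratic : (a b c : ℤ) → Coefficients
  rational  : (b c : ℤ) → Coefficients

polynomial : Coefficients → ℤ[X]
polynomial (quadratic a b c) = c ∷ b ∷ a ∷ []
polynomial (rational b c)    = c ∷ b ∷ []

leading linear constant : Coefficients → ℤ
leading (quadratic a b c) = a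
leading (rational b c)    = b
linear (quadratic a b c) = b
linear (rational b c)    = b
constant (quadratic a b c) = c
constant (rational b c)    = c

module Expansions (p : ℕ) (p-prime : Prime p) where

  private instance
    p≢0 : NonZero p
    p≢0 = prime⇒nonZero p-prime

  p^ : ℕ → ℤ
  p^ n = + (p ℕ.^ n)

  -- ℤₚ is the inverse limit of the rings ℤ/pⁿ; approx n is a representative
  -- modulo pⁿ.

  record ℤₚ : Set where
    field
      approx   : ℕ → ℤ
      coherent : ∀ n → p^ n ∣ approx (suc n) - approx n
  open ℤₚ public

  infix  4 _≈_ _∈p^_
  infixl 6 _⊕_
  infixl 7 _⊗_
  infix  8 ⊖_

  _≈_ : ℤₚ → ℤₚ → Set
  x ≈ y = ∀ n → p^ n ∣ approx x n - approx y n

  ⟪_⟫ : ℤ → ℤₚ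
  ⟪ a ⟫ = record
    { approx   = λ _ → a
    ; coherent = λ _ → divides 0ℤ (+-inverseʳ a)
    }

  _⊕_ : ℤₚ → ℤₚ → ℤₚ
  x ⊕ y = record
    { approx   = λ n → approx x n + approx y n
    ; coherent = λ n → subst (p^ n ∣_)
        (rearrange (approx x (suc n)) (approx x n) (approx y (suc n)) (approx y n))
        (∣m∣n⇒∣m+n (coherent x n) (coherent y n))
    }
    where
    rearrange : ∀ a b c d → (a - b) + (c - d) ≡ (a + c) - (b + d)
    rearrange = ℤ-Solver.solve-∀

  _⊗_ : ℤₚ → ℤₚ → ℤₚ
  x ⊗ y = record
    { approx   = λ n → approx x n * approx y n
    ; coherent = λ n → subst (p^ n ∣_)
        (rearrange (approx x (suc n)) (approx x n) (approx y (suc n)) (approx y n))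
        (∣m∣n⇒∣m+n (∣m⇒∣m*n (approx y (suc n)) (coherent x n))
                   (∣n⇒∣m*n (approx x n) (coherent y n)))
    }
    where
    rearrange : ∀ a b c d → (a - b) * c + b * (c - d) ≡ a * c - b * d
    rearrange = ℤ-Solver.solve-∀

  ⊖_ : ℤₚ → ℤₚ
  ⊖ x = ⟪ - 1ℤ ⟫ ⊗ x

  _∈p^_ : ℤₚ → ℕ → Set
  x ∈p^ k = ∃[ w ] x ≈ ⟪ p^ k ⟫ ⊗ w

  -- vₚ(x) = k for x ≠ 0.

  HasValuation : ℤₚ → ℕ → Set
  HasValuation x k = x ∈p^ k × ¬ (x ∈p^ suc k)

  eval : ℤ[X] → ℤₚ → ℤₚ
  eval []      x = ⟪ 0ℤ ⟫
  eval (a ∷ f) x = ⟪ a ⟫ ⊕ x ⊗ eval f x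

  -- The i-th digit in the expansion x = Σ_{i ≥ 0} eᵢ pⁱ.

  digit : ℤₚ → ℕ → ℕ
  digit x i = (approx x (suc i) %ℕ p ℕ.^ suc i) ℕ./ p ℕ.^ i
    where instance
      p^i≢0 : NonZero (p ℕ.^ i)
      p^i≢0 = m^n≢0 p i

      p^1+i≢0 : NonZero (p ℕ.^ suc i)
      p^1+i≢0 = m^n≢0 p (suc i)

  Σdigits : ℤₚ → ℕ → ℕ
  Σdigits x zero    = 0
  Σdigits x (suc n) = Σdigits x n ℕ.+ digit x n ℕ.* p ℕ.^ n

  -- The element num / p^shift; its digit at pⁱ is the digit of num at
  -- p^(i + shift).

  record ℚₚ : Set where
    constructor _/p^_
    field
      num   : ℤₚ
      shift : ℕ
  open ℚₚ public

  infix 4 _≈ℚ_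

  _≈ℚ_ : ℚₚ → ℚₚ → Set
  (x /p^ m) ≈ℚ (y /p^ n) = ⟪ p^ n ⟫ ⊗ x ≈ ⟪ p^ m ⟫ ⊗ y

  ι : ℤₚ → ℚₚ
  ι x = x /p^ 0

  -- [ α ] keeps the digits at pⁱ with i ≤ 0, that of p⁰ included.

  [_] : ℚₚ → ℚₚ
  [ x /p^ m ] = ⟪ + Σdigits x (suc m) ⟫ /p^ m

  ⟨_⟩ : ℚₚ → ℚₚ
  ⟨ x /p^ m ⟩ = (x ⊕ ⊖ ⟪ + Σdigits x (suc m) ⟫) /p^ m

  -- For lists f with non-zero leading coefficient, "minimal" says that no
  -- non-zero polynomial of smaller degree vanishes at x.

  record IsMinimalPolynomial (x : ℤₚ) (m : Coefficients) : Set where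
    field
      root      : eval (polynomial m) x ≈ ⟪ 0ℤ ⟫
      minimal   : ∀ g → length g ℕ.< length (polynomial m) →
                  eval g x ≈ ⟪ 0ℤ ⟫ → g ≈ᴾ []
      positive  : 0ℤ < leading m
      coprime   : ∀ e → All (e ∣_) (polynomial m) → e ∣ 1ℤ

  -- The minimal polynomial is determined by the element, so carrying it adds
  -- no information.

  record Aₚ : Set where
    field
      element             : ℤₚ
      element∈pℤₚ         : element ∈p^ 1
      minPoly             : Coefficients
      isMinimalPolynomial : IsMinimalPolynomial element minPoly

    b c : ℤ
    b = linear minPoly
    c = constant minPoly
  open Aₚ public using (element; minPoly)

  -- u = a |a|ₚ for a non-zero integer a.

  IsUnitPart : ℤ → ℤ → Set
  IsUnitPart a u = ∃[ j ] a ≡ u * p^ j × ¬ (+ p ∣ u)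

  -- The graph of x ↦ (t(x), vₚ(x), d(x), T(x)) on Aₚ ∖ {0}.  The defining
  -- equation T(x) = t pᵏ / x - d is cleared of its denominator; T(x) ∈ pℤₚ,
  -- which pins down d, is part of y : Aₚ.  No y is related to x = 0, which has
  -- no valuation.

  record Step (alg : Algorithm) (x : Aₚ) (t : ℤ) (k d : ℕ) (y : Aₚ) : Set where
    field
      u           : ℤ
      isUnitPart  : IsUnitPart (Aₚ.c x) u
      numerator   : t ≡ signed (branch alg (Aₚ.b x) (Aₚ.c x)) u
      valuation   : HasValuation (element x) k
      1≤d         : 1 ℕ.≤ d
      d<p         : d ℕ.< p
      transformed : (element y ⊕ ⟪ + d ⟫) ⊗ element x ≈ ⟪ t * p^ k ⟫

  -- An expansion that never terminates.  Here orbit i is Tⁱ(⟨α⟩), so the term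
  -- with index i is the one written tᵢ₊₁, kᵢ₊₁, dᵢ₊₁ when counting from one.
  -- As α - ⟨α⟩ is rational, ⟨α⟩ ∈ Aₚ says that α is algebraic of degree at
  -- most two.

  record InfiniteExpansion (alg : Algorithm) (α : ℚₚ) : Set where
    field
      orbit : ℕ → Aₚ
      t     : ℕ → ℤ
      k d   : ℕ → ℕ
      start : ι (element (orbit 0)) ≈ℚ ⟨ α ⟩
      step  : ∀ i → Step alg (orbit i) (t i) (k i) (d i) (orbit (suc i))

  record PurelyPeriodic (alg : Algorithm) (α : ℚₚ) : Set where
    field
      expansion    : InfiniteExpansion alg α
      integralPart : [ α ] ≈ℚ ι ⟪ 0ℤ ⟫
    open InfiniteExpansion expansion
    field
      ℓ        : ℕ
      1≤ℓ      : 1 ℕ.≤ ℓ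
      periodic : ∀ i → t (i ℕ.+ ℓ) ≡ t i × k (i ℕ.+ ℓ) ≡ k i × d (i ℕ.+ ℓ) ≡ d i

  Reduced : Algorithm → Pred ℚₚ 0ℓ
  Reduced = PurelyPeriodic

  S S₁ S₃ S₄ R R₁ P₁ : Pred (ℤ × ℤ) 0ℓ
  S  (b , c) = ¬ (+ p ∣ b) × + p ∣ c × Irreducible (c ∷ b ∷ 1ℤ ∷ [])
  S₁ (b , c) = S (b , c) × 0ℤ < b × 0ℤ < c
  S₃ (b , c) = S (b , c) × b < 0ℤ × c < 0ℤ
  S₄ (b , c) = S (b , c) × 0ℤ < b × c < 0ℤ
  R  (b , c) = S (b , c) × 1ℤ ≤ b × b ≤ + p - 1ℤ
  R₁ (b , c) = S₁ (b , c) × 1ℤ ≤ b × b ≤ + p - 1ℤ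

  -- For a positive integer b, [b] is the residue b %ℕ p and ⟨b⟩ = b - [b].

  P₁ (b , c) = S₁ (b , c) × ¬ R₁ (b , c) ×
               c < + (b %ℕ p) * (b - + (b %ℕ p))

  -- The set of Hensel roots identified with a set of pairs: (b , c) stands for
  -- the root of X² + bX + c in pℤₚ.

  HenselRoots : Pred (ℤ × ℤ) 0ℓ → Pred ℚₚ 0ℓ
  HenselRoots P α = Σ[ (b , c) ∈ ℤ × ℤ ] P (b , c) × (∃[ x ]
    ι x ≈ℚ α × x ∈p^ 1 × eval (c ∷ b ∷ 1ℤ ∷ []) x ≈ ⟪ 0ℤ ⟫)

{-# OPTIONS --safe #-}
module Submission where

-- Suppose that x ∈ pℤₚ is a root of aX² + bX + c with p ∤ b.  Then
-- -c / x = ax + b, so that T(x) = ±(ax + b) - d is a root of the monic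
-- polynomial X² + (2d - β)X + (ac + d(d - β)) with β = ±b, where the sign is +
-- for T₂, and d is the residue of β modulo p.
--
-- In a purely periodic expansion x is a fixed point of a product of matrices
-- (0 , tpᵏ ; 1 , d), whose quadratic equation has a middle coefficient prime to
-- p; hence p ∤ b.  Every element of the orbit is an image under T, so a = 1.
-- Rational elements do not occur, as their expansions terminate.  What remains
-- is to find the periodic points of
-- (b , c) ↦ (2d - β , c + d(d - β)), which preserves b² - 4c.  For A this map is
-- an involution.  For B it is the identity on R, and |b| decreases until R is
-- reached.  For C the claimed set is mapped injectively into itself and contains
-- finitely many pairs of a given discriminant, and |b| decreases until it is
-- reached.
--
-- Conversely the orbit of a pair determines an expansion of its Hensel root, as
-- T(x) = ±(x + b) - d needs no division.

open import Defs
open import Algebra.Bundles using (RawSemiring)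
open import Data.Empty using (⊥)
open import Data.Fin.Base as Fin using (Fin; toℕ; fromℕ<)
import Data.Fin.Properties as Fin
open import Data.Integer.Base
  using (ℤ; +_; -[1+_]; -_; _+_; _-_; _*_; _≤_; _<_; 0ℤ; 1ℤ; +≤+; +<+; -<-)
  renaming (∣_∣ to abs)
import Data.Integer.Base as ℤ
open import Data.Integer.DivMod using (_%ℕ_; _/ℕ_; n%ℕd<d; a≡a%ℕn+[a/ℕn]*n)
open import Data.Integer.Divisibility.Signed
import Data.Integer.Properties as ℤ
open import Data.Integer.Tactic.RingSolver using (solve-∀)
open import Data.List.Base using ([]; _∷_; length; map)
open import Data.List.Relation.Unary.All using ([]; _∷_)
open import Data.Nat using (ℕ)
open import Data.Nat.Base as ℕ using (zero; suc; NonZero; z≤n; s≤s)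
import Data.Nat.Divisibility as ℕ
import Data.Nat.DivMod as ℕ
import Data.Nat.Coprimality as Coprimality
import Data.Nat.GCD as ℕ
open import Data.Nat.Primality using (Prime; prime⇒nonZero; prime⇒nonTrivial; euclidsLemma)
import Data.Nat.Properties as ℕ
open import Data.Product using (Σ-syntax; ∃-syntax; _×_; _,_; proj₁; proj₂)
open import Data.Sum using (_⊎_; inj₁; inj₂; [_,_]′)
open import Function.Base using (_∘_)
open import Level using (0ℓ)
open import Relation.Binary.Definitions using (tri<; tri≈; tri>)
open import Relation.Binary.PropositionalEquality
  using (_≡_; _≢_; refl; sym; trans; cong; cong₂; subst; subst₂)
open import Relation.Nullary using (¬_; yes; no; contradiction)
open import Relation.Nullary.Decidable using (dec-true; dec-false)
open import Relation.Unary using (Pred; _≐_; _∪_)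

-- Divisibility and order in the integers

∣-respʳ : ∀ {m a b} → a ≡ b → m ∣ a → m ∣ b
∣-respʳ refl m∣a = m∣a

0<⇒< : ∀ {i j} → 0ℤ < j - i → i < j
0<⇒< {i} {j} 0<j-i = subst₂ _<_ (ℤ.+-identityʳ i) (i+[j-i] i j) (ℤ.+-monoʳ-< i 0<j-i)
  where
  i+[j-i] : ∀ i j → i + (j - i) ≡ j
  i+[j-i] = solve-∀

<⇒0< : ∀ {i j} → i < j → 0ℤ < j - i
<⇒0< {i} {j} i<j = subst (_< j - i) (ℤ.+-inverseʳ i) (ℤ.+-monoˡ-< (- i) i<j)

0<* : ∀ {i j} → 0ℤ < i → 0ℤ < j → 0ℤ < i * j
0<* {+ suc _} {+ suc _} _ _ = +<+ (s≤s z≤n)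
0<* {+ 0} (+<+ ())
0<* {+ suc _} {+ 0} _ (+<+ ())

0<-via : ∀ {i j k} → 0ℤ < k → k ≡ j - i → i < j
0<-via 0<k refl = 0<⇒< 0<k

∣∣-mono-< : ∀ {i j} → - j < i → i < j → abs i ℕ.< abs j
∣∣-mono-< {+ _}     {+ _}     _      (+<+ m<n) = m<n
∣∣-mono-< { -[1+ m ]} {+ suc n} (-<- m<n) _ = s≤s m<n
∣∣-mono-< { -[1+ m ]} {+ 0} () _
∣∣-mono-< { -[1+ m ]} { -[1+ n ]} () _

m∣n∧n<m⇒n≡0 : ∀ {m n} → m ℕ.∣ n → n ℕ.< m → n ≡ 0
m∣n∧n<m⇒n≡0 {n = zero}  _   _   = refl
m∣n∧n<m⇒n≡0 {n = suc _} m∣n n<m = contradiction (ℕ.∣⇒≤ m∣n) (ℕ.<⇒≱ n<m)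

-- The working form of irreducibility. A monic quadratic over ℤ can split only into linear factors
-- with leading coefficients 1 or -1, so it is irreducible exactly when no integer is a root.
NoRoot : ℤ → ℤ → Set
NoRoot b c = ∀ r → r * (r + b) + c ≢ 0ℤ

NoRoot⇒c≢0 : ∀ {b c} → NoRoot b c → c ≢ 0ℤ
NoRoot⇒c≢0 {b} noRoot refl = noRoot 0ℤ refl

-- Integral polynomials

-- An upper bound for the degree that is insensitive to trailing zeros.
Above : ℕ → Pred ℤ[X] 0ℓ
Above m f = ∀ i → m ℕ.< i → coeff f i ≡ 0ℤ

coeff-+ᴾ : ∀ f g n → coeff (f +ᴾ g) n ≡ coeff f n + coeff g n
coeff-+ᴾ []      g       n       = sym (ℤ.+-identityˡ (coeff g n))
coeff-+ᴾ (a ∷ f) []      n       = sym (ℤ.+-identityʳ (coeff (a ∷ f) n))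
coeff-+ᴾ (a ∷ f) (b ∷ g) zero    = refl
coeff-+ᴾ (a ∷ f) (b ∷ g) (suc n) = coeff-+ᴾ f g n

coeff-map : ∀ a f n → coeff (map (a *_) f) n ≡ a * coeff f n
coeff-map a []      n       = sym (ℤ.*-zeroʳ a)
coeff-map a (b ∷ f) zero    = refl
coeff-map a (b ∷ f) (suc n) = coeff-map a f n

coeff-*ᴾ-suc : ∀ a f g n → coeff ((a ∷ f) *ᴾ g) (suc n) ≡ a * coeff g (suc n) + coeff (f *ᴾ g) n
coeff-*ᴾ-suc a f g n = trans (coeff-+ᴾ (map (a *_) g) (0ℤ ∷ (f *ᴾ g)) (suc n))
  (cong (_+ coeff (f *ᴾ g) n) (coeff-map a g (suc n)))

coeff-*ᴾ-0 : ∀ f g → coeff (f *ᴾ g) 0 ≡ coeff f 0 * coeff g 0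
coeff-*ᴾ-0 []      g = refl
coeff-*ᴾ-0 (a ∷ f) g = trans (coeff-+ᴾ (map (a *_) g) (0ℤ ∷ (f *ᴾ g)) 0)
  (trans (ℤ.+-identityʳ _) (coeff-map a g 0))

coeff-*ᴾ-1 : ∀ f g → coeff (f *ᴾ g) 1 ≡ coeff f 0 * coeff g 1 + coeff f 1 * coeff g 0
coeff-*ᴾ-1 []      g = refl
coeff-*ᴾ-1 (a ∷ f) g = trans (coeff-*ᴾ-suc a f g 0) (cong (_+_ (a * coeff g 1)) (coeff-*ᴾ-0 f g))

*ᴾ-zeroˡ : ∀ f g → f ≈ᴾ [] → f *ᴾ g ≈ᴾ []
*ᴾ-zeroˡ []      g f≈0 n       = refl
*ᴾ-zeroˡ (a ∷ f) g f≈0 zero    = trans (coeff-*ᴾ-0 (a ∷ f) g) (cong (_* coeff g 0) (f≈0 0))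
*ᴾ-zeroˡ (a ∷ f) g f≈0 (suc n) = trans (coeff-*ᴾ-suc a f g n)
  (cong₂ _+_ (cong (_* coeff g (suc n)) (f≈0 0)) (*ᴾ-zeroˡ f g (f≈0 ∘ suc) n))

*ᴾ-zeroʳ : ∀ f g → g ≈ᴾ [] → f *ᴾ g ≈ᴾ []
*ᴾ-zeroʳ []      g g≈0 n       = refl
*ᴾ-zeroʳ (a ∷ f) g g≈0 zero    = trans (coeff-*ᴾ-0 (a ∷ f) g)
  (trans (cong (a *_) (g≈0 0)) (ℤ.*-zeroʳ a))
*ᴾ-zeroʳ (a ∷ f) g g≈0 (suc n) = trans (coeff-*ᴾ-suc a f g n)
  (cong₂ _+_ (trans (cong (a *_) (g≈0 (suc n))) (ℤ.*-zeroʳ a)) (*ᴾ-zeroʳ f g g≈0 n))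

*ᴾ-above : ∀ {m n} f g → Above m f → Above n g → Above (m ℕ.+ n) (f *ᴾ g)
*ᴾ-above []      g f-above g-above i       _ = refl
*ᴾ-above {m} {n} (a ∷ f) g f-above g-above (suc i) (s≤s m+n≤i) = trans (coeff-*ᴾ-suc a f g i)
  (cong₂ _+_ (trans (cong (a *_) (g-above (suc i) (s≤s (ℕ.m+n≤o⇒n≤o m m+n≤i)))) (ℤ.*-zeroʳ a))
             (tail m f-above m+n≤i))
  where
  -- For m = 0 the tail `f` is zero; otherwise its degree bound is smaller by one.
  tail : ∀ m → Above m (a ∷ f) → m ℕ.+ n ℕ.≤ i → coeff (f *ᴾ g) i ≡ 0ℤ
  tail zero    f-above _     = *ᴾ-zeroˡ f g (λ j → f-above (suc j) (s≤s z≤n)) i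
  tail (suc m) f-above m+n<i = *ᴾ-above f g (λ j m<j → f-above (suc j) (s≤s m<j)) g-above i m+n<i

*ᴾ-top : ∀ {m n} f g → Above m f → Above n g →
         coeff (f *ᴾ g) (m ℕ.+ n) ≡ coeff f m * coeff g n
*ᴾ-top                      []      g f-above g-above = refl
*ᴾ-top {zero}  {zero}  (a ∷ f) g f-above g-above = coeff-*ᴾ-0 (a ∷ f) g
*ᴾ-top {zero}  {suc n} (a ∷ f) g f-above g-above = trans (coeff-*ᴾ-suc a f g n)
  (trans (cong (_+_ (a * coeff g (suc n))) (*ᴾ-zeroˡ f g (λ j → f-above (suc j) (s≤s z≤n)) n))
         (ℤ.+-identityʳ _))
*ᴾ-top {suc m} {n}     (a ∷ f) g f-above g-above = trans (coeff-*ᴾ-suc a f g (m ℕ.+ n))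
  (trans (cong₂ _+_ (trans (cong (a *_) (g-above (suc (m ℕ.+ n)) (s≤s (ℕ.m≤n+m n m)))) (ℤ.*-zeroʳ a))
                    (*ᴾ-top f g (λ j m<j → f-above (suc j) (s≤s m<j)) g-above))
         (ℤ.+-identityˡ _))

-- Trailing zeros make the length unreliable, so the recursion looks for the last non-zero
-- coefficient from the far end.
degree : ∀ f → f ≈ᴾ [] ⊎ (∃[ m ] coeff f m ≢ 0ℤ × Above m f)
degree []      = inj₁ (λ _ → refl)
degree (a ∷ f) with degree f
... | inj₂ (m , top≢0 , above) = inj₂ (suc m , top≢0 , λ where (suc i) (s≤s m<i) → above i m<i)
... | inj₁ f≈0 with a ℤ.≟ 0ℤ
...   | yes refl = inj₁ λ where zero → refl ; (suc n) → f≈0 n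
...   | no  a≢0  = inj₂ (0 , a≢0 , λ where (suc i) _ → f≈0 i)

i*j≢0 : ∀ {i j} → i ≢ 0ℤ → j ≢ 0ℤ → i * j ≢ 0ℤ
i*j≢0 {i} i≢0 j≢0 ij≡0 with ℤ.i*j≡0⇒i≡0∨j≡0 i ij≡0
... | inj₁ i≡0 = i≢0 i≡0
... | inj₂ j≡0 = j≢0 j≡0

1ᴾ : ℤ[X]
1ᴾ = 1ℤ ∷ []

-- If q has degree k, the product has a non-zero coefficient at k + m + 1, where the polynomial 1
-- has none.
*ᴾ-monic≉1 : ∀ {m} q f → Above (suc m) f → coeff f (suc m) ≡ 1ℤ → ¬ (q *ᴾ f ≈ᴾ 1ᴾ)
*ᴾ-monic≉1 {m} q f f-above monic qf≈1 with degree q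
... | inj₁ q≈0 with () ← trans (sym (*ᴾ-zeroˡ q f q≈0 0)) (qf≈1 0)
... | inj₂ (k , top≢0 , q-above) = i*j≢0 top≢0 (λ fₘ≡0 → contradiction (trans (sym monic) fₘ≡0) λ ())
  (trans (sym (*ᴾ-top q f q-above f-above))
  (trans (qf≈1 (k ℕ.+ suc m)) (cong (coeff 1ᴾ) (ℕ.+-suc k m))))

quadratic-above : ∀ b c → Above 2 (c ∷ b ∷ 1ℤ ∷ [])
quadratic-above b c (suc (suc (suc i))) _ = refl
quadratic-above b c (suc (suc zero)) (s≤s (s≤s ()))
quadratic-above b c (suc zero) (s≤s ())

-- A root r yields the factorization (X - r)(X + b + r), and monic linear factors are not units.
irreducible⇒noRoot : ∀ {b c} → Irreducible (c ∷ b ∷ 1ℤ ∷ []) → NoRoot b c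
irreducible⇒noRoot {b} {c} irreducible r root
  with irreducible.split-∣1 {(- r) ∷ 1ᴾ} {(b + r) ∷ 1ᴾ} factored
  where
  module irreducible = Irreducible irreducible
  solve-c : ∀ b c r → c ≡ (r * (r + b) + c) + (- r * (b + r) + 0ℤ)
  solve-c = solve-∀
  solve-b : ∀ b r → b ≡ - r * 1ℤ + (1ℤ * (b + r) + 0ℤ)
  solve-b = solve-∀
  factored : (c ∷ b ∷ 1ℤ ∷ []) ≈ᴾ ((- r) ∷ 1ᴾ) *ᴾ ((b + r) ∷ 1ᴾ)
  factored 0 = trans (solve-c b c r) (trans (cong (_+ _) root) (ℤ.+-identityˡ _))
  factored 1 = solve-b b r
  factored 2 = refl
  factored (suc (suc (suc _))) = refl
... | inj₁ record { quotient = q ; equality = qf≈1 } =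
  *ᴾ-monic≉1 {0} q ((- r) ∷ 1ᴾ) (λ where (suc (suc _)) _ → refl ; (suc zero) (s≤s ())) refl qf≈1
... | inj₂ record { quotient = q ; equality = qf≈1 } =
  *ᴾ-monic≉1 {0} q ((b + r) ∷ 1ᴾ) (λ where (suc (suc _)) _ → refl ; (suc zero) (s≤s ())) refl qf≈1

constant∣1 : ∀ f a → Above 0 f → a * coeff f 0 ≡ 1ℤ → (a ∷ []) *ᴾ f ≈ᴾ 1ᴾ
constant∣1 f a f-above af₀≡1 zero    = trans (coeff-*ᴾ-0 (a ∷ []) f) af₀≡1
constant∣1 f a f-above af₀≡1 (suc n) = trans (coeff-*ᴾ-suc a [] f n)
  (trans (ℤ.+-identityʳ _) (trans (cong (a *_) (f-above (suc n) (s≤s z≤n))) (ℤ.*-zeroʳ a)))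

-- The degrees of two factors add up to 2. A constant factor is a unit because the leading
-- coefficients multiply to 1; two linear factors produce an integral root.
noRoot⇒irreducible : ∀ {b c} → NoRoot b c → Irreducible (c ∷ b ∷ 1ℤ ∷ [])
noRoot⇒irreducible {b} {c} noRoot = record
  { p∤1      = λ f∣1 → *ᴾ-monic≉1 (∣ʳ.quotient f∣1) f (quadratic-above b c) refl (∣ʳ.equality f∣1)
  ; split-∣1 = λ {g} {h} f≈gh → split g h f≈gh (degree g) (degree h)
  }
  where

  open RawSemiring ℤ[X]-rawSemiring using (*-rawMagma)
  open import Algebra.Definitions.RawMagma *-rawMagma using (_∣ʳ_) renaming (_∣_ to _∣ᴾ_)
  module ∣ʳ = _∣ʳ_

  f : ℤ[X]
  f = c ∷ b ∷ 1ℤ ∷ []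

  unit : ∀ g a → Above 0 g → a * coeff g 0 ≡ 1ℤ → g ∣ᴾ 1ᴾ
  unit g a g-above ag₀≡1 = record
    { quotient = a ∷ [] ; equality = constant∣1 g a g-above ag₀≡1 }

  split : ∀ g h → f ≈ᴾ g *ᴾ h →
          g ≈ᴾ [] ⊎ (∃[ m ] coeff g m ≢ 0ℤ × Above m g) →
          h ≈ᴾ [] ⊎ (∃[ n ] coeff h n ≢ 0ℤ × Above n h) → g ∣ᴾ 1ᴾ ⊎ h ∣ᴾ 1ᴾ
  split g h f≈gh (inj₁ g≈0) _ with () ← trans (f≈gh 2) (*ᴾ-zeroˡ g h g≈0 2)
  split g h f≈gh (inj₂ _) (inj₁ h≈0) with () ← trans (f≈gh 2) (*ᴾ-zeroʳ g h h≈0 2)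
  split g h f≈gh (inj₂ (m , gₘ≢0 , g-above)) (inj₂ (n , hₙ≢0 , h-above))
    with ℕ.<-cmp (m ℕ.+ n) 2
  ... | tri< m+n<2 _ _ with () ← trans (f≈gh 2) (*ᴾ-above g h g-above h-above 2 m+n<2)
  ... | tri> _ _ 2<m+n = contradiction
    (trans (sym (*ᴾ-top g h g-above h-above))
      (trans (sym (f≈gh (m ℕ.+ n))) (quadratic-above b c (m ℕ.+ n) 2<m+n)))
    (i*j≢0 gₘ≢0 hₙ≢0)
  split g h f≈gh (inj₂ (0 , _ , g-above)) (inj₂ (2 , _ , h-above)) | tri≈ _ refl _ =
    inj₁ (unit g (coeff h 2) g-above
      (trans (ℤ.*-comm (coeff h 2) (coeff g 0)) (sym (trans (f≈gh 2) (*ᴾ-top g h g-above h-above)))))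
  split g h f≈gh (inj₂ (2 , _ , g-above)) (inj₂ (0 , _ , h-above)) | tri≈ _ refl _ =
    inj₂ (unit h (coeff g 2) h-above (sym (trans (f≈gh 2) (*ᴾ-top g h g-above h-above))))
  -- As g₁ h₁ = 1, the root - g₀ / g₁ of g is the integer - g₀ h₁.
  split g h f≈gh (inj₂ (1 , _ , g-above)) (inj₂ (1 , _ , h-above)) | tri≈ _ refl _ =
    contradiction
      (trans (cong₂ (λ b c → - (g₀ * h₁) * (- (g₀ * h₁) + b) + c)
                    (trans (f≈gh 1) (coeff-*ᴾ-1 g h)) (trans (f≈gh 0) (coeff-*ᴾ-0 g h)))
      (trans (factor g₀ g₁ h₀ h₁)
      (trans (cong (λ e → g₀ * h₀ * (1ℤ - e)) (sym (trans (f≈gh 2) (*ᴾ-top g h g-above h-above))))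
             (ℤ.*-zeroʳ (g₀ * h₀)))))
      (noRoot (- (g₀ * h₁)))
    where
    g₀ = coeff g 0
    g₁ = coeff g 1
    h₀ = coeff h 0
    h₁ = coeff h 1
    factor : ∀ g₀ g₁ h₀ h₁ → - (g₀ * h₁) * (- (g₀ * h₁) + (g₀ * h₁ + g₁ * h₀)) + g₀ * h₀ ≡
                             g₀ * h₀ * (1ℤ - g₁ * h₁)
    factor = solve-∀

-- The rational root theorem for the root - m / n. In lowest terms the denominator divides the
-- square of the numerator, hence the numerator, so the root is an integer.
noRoot⇒noRationalRoot : ∀ {b c} → NoRoot b c → ∀ m n →
  m * m - b * (m * n) + c * (n * n) ≡ 0ℤ → n ≡ 0ℤ
noRoot⇒noRationalRoot {b} {c} noRoot m n root with n ℤ.≟ 0ℤ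
... | yes n≡0 = n≡0
... | no  n≢0 = contradiction monic-root (noRoot (- k))
  where
  g = + ℕ.gcd (abs n) (abs m)
  g∣n : g ∣ n
  g∣n = ∣ᵤ⇒∣ (ℕ.gcd[m,n]∣m (abs n) (abs m))
  g∣m : g ∣ m
  g∣m = ∣ᵤ⇒∣ (ℕ.gcd[m,n]∣n (abs n) (abs m))
  n′ = quotient g∣n
  m′ = quotient g∣m
  n≡ : n ≡ n′ * g
  n≡ = _∣_.equality g∣n
  m≡ : m ≡ m′ * g
  m≡ = _∣_.equality g∣m
  instance
    g-nonZero : ℤ.NonZero g
    g-nonZero = ℤ.≢-nonZero λ g≡0 → n≢0 (trans n≡ (trans (cong (n′ *_) g≡0) (ℤ.*-zeroʳ n′)))
    n-nonZero : ℤ.NonZero n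
    n-nonZero = ℤ.≢-nonZero n≢0

  coprime : Coprimality.Coprime (abs n′) (abs m′)
  coprime {i} (i∣n′ , i∣m′) = ℕ.∣1⇒≡1 (ℕ.*-cancelʳ-∣ (abs g)
    (subst (i ℕ.* abs g ℕ.∣_) (sym (ℕ.*-identityˡ (abs g)))
    (ℕ.gcd-greatest (subst (i ℕ.* abs g ℕ.∣_) (sym (trans (cong abs n≡) (ℤ.abs-* n′ g))) (ℕ.*-monoˡ-∣ (abs g) i∣n′))
                    (subst (i ℕ.* abs g ℕ.∣_) (sym (trans (cong abs m≡) (ℤ.abs-* m′ g))) (ℕ.*-monoˡ-∣ (abs g) i∣m′)))))

  reduced : m′ * m′ - b * (m′ * n′) + c * (n′ * n′) ≡ 0ℤ
  reduced = ℤ.*-cancelʳ-≡ _ 0ℤ g (ℤ.*-cancelʳ-≡ _ (0ℤ * g) g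
    (trans (sym (homogeneous b c m′ n′ g))
           (subst₂ (λ m n → m * m - b * (m * n) + c * (n * n) ≡ 0ℤ) m≡ n≡ root)))
    where
    homogeneous : ∀ b c m n g →
      (m * g) * (m * g) - b * ((m * g) * (n * g)) + c * ((n * g) * (n * g)) ≡
      (m * m - b * (m * n) + c * (n * n)) * g * g
    homogeneous = solve-∀

  n′∣m′ : n′ ∣ m′
  n′∣m′ = ∣ᵤ⇒∣ (Coprimality.coprime-divisor coprime
    (subst (abs n′ ℕ.∣_) (ℤ.abs-* m′ m′) (∣⇒∣ᵤ {n′} (divides (b * m′ - c * n′)
      (trans (isolate b c m′ n′) (trans (cong (_+ (b * m′ - c * n′) * n′) reduced) (ℤ.+-identityˡ _)))))))
    where
    isolate : ∀ b c m n → m * m ≡ (m * m - b * (m * n) + c * (n * n)) + (b * m - c * n) * n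
    isolate = solve-∀

  k = quotient n′∣m′

  m≡kn : m ≡ k * n
  m≡kn = trans m≡ (trans (cong (_* g) (_∣_.equality n′∣m′))
    (trans (ℤ.*-assoc k n′ g) (cong (k *_) (sym n≡))))

  monic-root : - k * (- k + b) + c ≡ 0ℤ
  monic-root = ℤ.*-cancelʳ-≡ _ 0ℤ n (ℤ.*-cancelʳ-≡ _ (0ℤ * n) n
    (trans (homogeneous b c k n)
           (subst (λ m → m * m - b * (m * n) + c * (n * n) ≡ 0ℤ) m≡kn root)))
    where
    homogeneous : ∀ b c k n → (- k * (- k + b) + c) * n * n ≡
      (k * n) * (k * n) - b * ((k * n) * n) + c * (n * n)
    homogeneous = solve-∀

-- T₂ has the numerator - u, and - c / x = ax + b; hence T₂ carries the sign + and T₁ the sign -.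
ε : Branch → ℤ
ε T₁ = - 1ℤ
ε T₂ = 1ℤ

branch-B-T₂ : ∀ {b c} → 0ℤ ≤ b → branch B b c ≡ T₂
branch-B-T₂ {b} 0≤b rewrite dec-true (0ℤ ℤ.≤? b) 0≤b = refl

branch-B-T₁ : ∀ {b c} → b < 0ℤ → branch B b c ≡ T₁
branch-B-T₁ {b} b<0 rewrite dec-false (0ℤ ℤ.≤? b) (ℤ.<⇒≱ b<0) = refl

branch-C-T₂ : ∀ {b c} → 0ℤ ≤ b → 0ℤ < c → branch C b c ≡ T₂
branch-C-T₂ {b} {c} 0≤b 0<c
  rewrite dec-true (0ℤ ℤ.≤? b) 0≤b | dec-true (0ℤ ℤ.<? c) 0<c = refl

branch-C-T₁ˡ : ∀ {b c} → b < 0ℤ → branch C b c ≡ T₁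
branch-C-T₁ˡ {b} b<0 rewrite dec-false (0ℤ ℤ.≤? b) (ℤ.<⇒≱ b<0) = refl

branch-C-T₁ʳ : ∀ {b c} → c < 0ℤ → branch C b c ≡ T₁
branch-C-T₁ʳ {b} {c} c<0 with 0ℤ ℤ.≤? b
... | no _ = refl
... | yes _ rewrite dec-false (0ℤ ℤ.<? c) (ℤ.<-asym c<0) = refl

module ReducedSets (p : ℕ) (p-prime : Prime p) where
  open Expansions p p-prime

  private instance
    p≢0 : NonZero p
    p≢0 = prime⇒nonZero p-prime

  -- Residues modulo p

  ∣-or-∣ : ∀ i j → + p ∣ i * j → + p ∣ i ⊎ + p ∣ j
  ∣-or-∣ i j p∣ij with euclidsLemma (abs i) (abs j) p-prime
                        (subst (p ℕ.∣_) (ℤ.abs-* i j) (∣⇒∣ᵤ p∣ij))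
  ... | inj₁ p∣i = inj₁ (∣ᵤ⇒∣ p∣i)
  ... | inj₂ p∣j = inj₂ (∣ᵤ⇒∣ p∣j)

  p∤small : ∀ {d} → 1 ℕ.≤ d → d ℕ.< p → ¬ (+ p ∣ + d)
  p∤small {suc d} _ d<p p∣d = ℕ.<⇒≱ d<p (ℕ.∣⇒≤ (∣⇒∣ᵤ p∣d))

  p∤1 : ¬ (+ p ∣ 1ℤ)
  p∤1 = p∤small ℕ.≤-refl (ℕ.nonTrivial⇒n>1 p)
    where instance _ = prime⇒nonTrivial p-prime

  p∣z-z%p : ∀ z → + p ∣ z - + (z %ℕ p)
  p∣z-z%p z = divides (z /ℕ p)
    (trans (cong (_- + (z %ℕ p)) (a≡a%ℕn+[a/ℕn]*n z p)) (cancel (+ (z %ℕ p)) ((z /ℕ p) * + p)))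
    where
    cancel : ∀ r q → (r + q) - r ≡ q
    cancel = solve-∀

  residue-injective : ∀ {d e} → d ℕ.< p → e ℕ.< p → + p ∣ + d - + e → d ≡ e
  residue-injective {d} {e} d<p e<p p∣d-e = ℤ.+-injective (ℤ.i-j≡0⇒i≡j (+ d) (+ e)
    (ℤ.∣i∣≡0⇒i≡0 (m∣n∧n<m⇒n≡0 (∣⇒∣ᵤ p∣d-e) (subst (ℕ._< p) (cong abs (sym (ℤ.[+m]-[+n]≡m⊖n d e)))
      (ℕ.≤-<-trans (ℤ.∣m⊝n∣≤m⊔n d e) (ℕ.⊔-lub d<p e<p))))))

  residue-unique : ∀ {d} z → d ℕ.< p → + p ∣ + d - z → z %ℕ p ≡ d
  residue-unique {d} z d<p p∣d-z = sym (residue-injective d<p (n%ℕd<d z p)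
    (∣-respʳ (telescope (+ d) z (+ (z %ℕ p))) (∣m∣n⇒∣m+n p∣d-z (p∣z-z%p z))))
    where
    telescope : ∀ a b c → (a - b) + (b - c) ≡ a - c
    telescope = solve-∀

  1≤%p : ∀ z → ¬ (+ p ∣ z) → 1 ℕ.≤ z %ℕ p
  1≤%p z p∤z with z %ℕ p | p∣z-z%p z
  ... | zero  | p∣z-0 = contradiction (∣-respʳ (ℤ.+-identityʳ z) p∣z-0) p∤z
  ... | suc _ | _     = s≤s z≤n

  %p-small : ∀ {z} → 0ℤ ≤ z → z < + p → + (z %ℕ p) ≡ z
  %p-small {+ n} _ (+<+ n<p) = cong +_ (ℕ.m<n⇒m%n≡m n<p)

  %p-≤ : ∀ {z} → 0ℤ ≤ z → + (z %ℕ p) ≤ z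
  %p-≤ {+ n} _ = +≤+ (ℕ.m%n≤m n p)

  -- The action on coefficients

  infixl 8 _mod
  _mod : ℤ → ℤ
  z mod = + (z %ℕ p)

  β : Algorithm → ℤ × ℤ → ℤ
  β alg (b , c) = ε (branch alg b c) * b

  -- (b , c) stands for the root x of X² + bX + c in pℤₚ, and next alg (b , c)
  -- for T(x).

  move : ℤ → ℤ → ℤ × ℤ
  move β c = (β mod + β mod) - β , c + β mod * (β mod - β)

  next : Algorithm → ℤ × ℤ → ℤ × ℤ
  next alg s = move (β alg s) (proj₂ s)

  -- The set `S` with irreducibility traded for the absence of integral roots, which is easier to
  -- carry through a step.
  record Hensel (s : ℤ × ℤ) : Set where
    constructor hensel
    field
      p∤b    : ¬ (+ p ∣ proj₁ s)
      p∣c    : + p ∣ proj₂ s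
      noRoot : NoRoot (proj₁ s) (proj₂ s)
  open Hensel public

  -- From z ≡ d follows 2d - z ≡ d. The digit thus survives a step, which is what makes `move`
  -- invertible.
  next-mod : ∀ z → ((z mod + z mod) - z) mod ≡ z mod
  next-mod z = cong +_ (residue-unique ((z mod + z mod) - z) (n%ℕd<d z p)
    (∣-respʳ (rearrange (z mod) z) (p∣z-z%p z)))
    where
    rearrange : ∀ d z → z - d ≡ d - ((d + d) - z)
    rearrange = solve-∀

  p∤mod : ∀ {z} → ¬ (+ p ∣ z) → ¬ (+ p ∣ z mod)
  p∤mod {z} p∤z = p∤small (1≤%p z p∤z) (n%ℕd<d z p)

  0<mod : ∀ {z} → ¬ (+ p ∣ z) → 0ℤ < z mod
  0<mod {z} p∤z = +<+ (1≤%p z p∤z)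

  mod<p : ∀ z → z mod < + p
  mod<p z = +<+ (n%ℕd<d z p)

  p∤ε* : ∀ br {b} → ¬ (+ p ∣ b) → ¬ (+ p ∣ ε br * b)
  p∤ε* T₁ {b} p∤b p∣-b = p∤b (∣-respʳ (double-neg b) (∣n⇒∣m*n (- 1ℤ) p∣-b))
    where
    double-neg : ∀ b → - 1ℤ * (- 1ℤ * b) ≡ b
    double-neg = solve-∀
  p∤ε* T₂ {b} p∤b p∣b = p∤b (∣-respʳ (ℤ.*-identityˡ b) p∣b)

  -- The roots of the new polynomial are - ε x̄ - d, where x̄ runs through the roots of the old one.
  -- Solving for x̄ turns an integral root r into the integral root r + d or - (r + d).
  NoRoot-shift : ∀ br d {b c} → NoRoot b c →
                 NoRoot ((d + d) - ε br * b) (c + d * (d - ε br * b))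
  NoRoot-shift T₁ d {b} {c} noRoot r root = noRoot (r + d) (trans (translate b c d r) root)
    where
    translate : ∀ b c d r → (r + d) * ((r + d) + b) + c ≡
            r * (r + ((d + d) - - 1ℤ * b)) + (c + d * (d - - 1ℤ * b))
    translate = solve-∀
  NoRoot-shift T₂ d {b} {c} noRoot r root = noRoot (- (r + d)) (trans (translate b c d r) root)
    where
    translate : ∀ b c d r → - (r + d) * (- (r + d) + b) + c ≡
            r * (r + ((d + d) - 1ℤ * b)) + (c + d * (d - 1ℤ * b))
    translate = solve-∀

  next-Hensel : ∀ alg {s} → Hensel s → Hensel (next alg s)
  next-Hensel alg {b , c} h = hensel
    (λ p∣b′ → p∤mod (p∤β) (∣-respʳ (rearrange (z mod) z)
        (∣m∣n⇒∣m+n p∣b′ (p∣z-z%p z))))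
    (∣m∣n⇒∣m+n (p∣c h) (∣n⇒∣m*n (z mod) (∣-respʳ (negate (z mod) z) (∣n⇒∣m*n (- 1ℤ) (p∣z-z%p z)))))
    (NoRoot-shift (branch alg b c) (z mod) (noRoot h))
    where
    z = β alg (b , c)
    p∤β = p∤ε* (branch alg b c) (p∤b h)
    rearrange : ∀ d z → ((d + d) - z) + (z - d) ≡ d
    rearrange = solve-∀
    negate : ∀ d z → - 1ℤ * (z - d) ≡ d - z
    negate = solve-∀

  -- Trajectories and their periodic points

  trajectory : Algorithm → ℤ × ℤ → ℕ → ℤ × ℤ
  trajectory alg s zero    = s
  trajectory alg s (suc n) = next alg (trajectory alg s n)

  Periodic : Algorithm → Pred (ℤ × ℤ) 0ℓ
  Periodic alg s = ∃[ ℓ ] 1 ℕ.≤ ℓ × trajectory alg s ℓ ≡ s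

  trajectory-Hensel : ∀ alg {s} → Hensel s → ∀ n → Hensel (trajectory alg s n)
  trajectory-Hensel alg h zero    = h
  trajectory-Hensel alg h (suc n) = next-Hensel alg (trajectory-Hensel alg h n)

  trajectory-periodic : ∀ alg {s ℓ} → trajectory alg s ℓ ≡ s →
                        ∀ n → trajectory alg s (n ℕ.+ ℓ) ≡ trajectory alg s n
  trajectory-periodic alg eq zero    = eq
  trajectory-periodic alg eq (suc n) = cong (next alg) (trajectory-periodic alg eq n)

  -- Outside of W the size of the linear coefficient decreases strictly, which
  -- cannot go on along a cycle.

  periodic-in : ∀ alg {W : Pred (ℤ × ℤ) 0ℓ} →
    (∀ {s} → Hensel s → W s → W (next alg s)) →
    (∀ {s} → Hensel s → W s ⊎ W (next alg s) ⊎ abs (proj₁ (next alg s)) ℕ.< abs (proj₁ s)) →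
    ∀ {s} → Hensel s → Periodic alg s → W s
  periodic-in alg {W} closed attracted {s} h (ℓ , 1≤ℓ , eq) with bound ℓ
    where
    bound : ∀ n → W (trajectory alg s n) ⊎
                  abs (proj₁ (trajectory alg s n)) ℕ.+ n ℕ.≤ abs (proj₁ s)
    bound zero    = inj₂ (ℕ.≤-reflexive (ℕ.+-identityʳ _))
    bound (suc n) with bound n | attracted (trajectory-Hensel alg h n)
    ... | inj₁ w | _             = inj₁ (closed (trajectory-Hensel alg h n) w)
    ... | inj₂ _ | inj₁ w        = inj₁ (closed (trajectory-Hensel alg h n) w)
    ... | inj₂ _ | inj₂ (inj₁ w) = inj₁ w
    ... | inj₂ q | inj₂ (inj₂ l) = inj₂ (ℕ.≤-trans (ℕ.≤-reflexive (ℕ.+-suc _ n))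
                                          (ℕ.≤-trans (ℕ.+-monoˡ-≤ n l) q))
  ... | inj₁ w = subst W eq w
  ... | inj₂ q = contradiction
    (subst (λ s′ → abs (proj₁ s′) ℕ.+ ℓ ℕ.≤ abs (proj₁ s)) eq q)
    (ℕ.<⇒≱ (ℕ.m<m+n _ 1≤ℓ))

  -- The second step has the same d = β mod p, so it undoes the reflection β ↦ 2d - β.

  A-periodic : ∀ s → Periodic A s
  A-periodic (b , c) = 2 , s≤s z≤n , cong₂ _,_
    (trans (cong (λ e → (e + e) - 1ℤ * b′) d′≡d) (back b d))
    (trans (cong (λ e → c′ + e * (e - 1ℤ * b′)) d′≡d) (forth b c d))
    where
    b′ = proj₁ (next A (b , c))
    c′ = proj₂ (next A (b , c))
    d = (1ℤ * b) mod
    d′≡d : (1ℤ * b′) mod ≡ d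
    d′≡d = trans (cong _mod (ℤ.*-identityˡ b′)) (next-mod (1ℤ * b))
    back : ∀ b d → (d + d) - 1ℤ * ((d + d) - 1ℤ * b) ≡ b
    back = solve-∀
    forth : ∀ b c d → (c + d * (d - 1ℤ * b)) + d * (d - 1ℤ * ((d + d) - 1ℤ * b)) ≡ c
    forth = solve-∀

  -- Here b is its own residue d, so the reflection b ↦ 2d - b fixes it and the correction d (d - b)
  -- vanishes.
  move-small : ∀ {b c} → 0ℤ ≤ b → b < + p → move b c ≡ (b , c)
  move-small {b} {c} 0≤b b<p =
    trans (cong (λ d → (d + d) - b , c + d * (d - b)) (%p-small 0≤b b<p))
          (cong₂ _,_ (fst b) (snd b c))
    where
    fst : ∀ b → (b + b) - b ≡ b
    fst = solve-∀
    snd : ∀ b c → c + b * (b - b) ≡ c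
    snd = solve-∀

  -- As 0 < d < p ≤ z, the reflected value 2d - z lies strictly between - z and z.
  ∣move∣-< : ∀ {z c} → ¬ (+ p ∣ z) → + p ≤ z → abs (proj₁ (move z c)) ℕ.< abs z
  ∣move∣-< {z} p∤z p≤z = ∣∣-mono-< {(z mod + z mod) - z} {z}
    (0<-via (ℤ.+-mono-<-≤ (0<mod p∤z) (ℤ.<⇒≤ (0<mod p∤z))) (lower (z mod) z))
    (0<-via (ℤ.+-mono-<-≤ 0<z-d (ℤ.<⇒≤ 0<z-d)) (upper (z mod) z))
    where
    0<z-d = <⇒0< (ℤ.<-≤-trans (mod<p z) p≤z)
    lower : ∀ d z → d + d ≡ ((d + d) - z) - (- z)
    lower = solve-∀
    upper : ∀ d z → (z - d) + (z - d) ≡ z - ((d + d) - z)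
    upper = solve-∀

  -- Periodic points of Algorithm B

  Small : Pred (ℤ × ℤ) 0ℓ
  Small (b , c) = 0ℤ < b × b < + p

  B-fixed : ∀ {s} → Small s → next B s ≡ s
  B-fixed {b , c} (0<b , b<p)
    rewrite branch-B-T₂ {b} {c} (ℤ.<⇒≤ 0<b) | ℤ.*-identityˡ b = move-small (ℤ.<⇒≤ 0<b) b<p

  p∤⇒≢0 : ∀ {b} → ¬ (+ p ∣ b) → b ≢ 0ℤ
  p∤⇒≢0 p∤0 refl = p∤0 (divides 0ℤ refl)

  ∣-b⇒∣b : ∀ {b} → + p ∣ - b → + p ∣ b
  ∣-b⇒∣b {b} p∣-b = ∣-respʳ (ℤ.neg-involutive b) (∣m⇒∣-m p∣-b)

  -- The sign of the branch replaces b by |b|. If |b| < p the image is (|b| , c), which is small;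
  -- otherwise the reflection shrinks |b|.
  B-attracted : ∀ {s} → Hensel s →
    Small s ⊎ Small (next B s) ⊎ abs (proj₁ (next B s)) ℕ.< abs (proj₁ s)
  B-attracted {b , c} h with ℤ.<-cmp b 0ℤ
  ... | tri≈ _ b≡0 _ = contradiction b≡0 (p∤⇒≢0 (p∤b h))
  ... | tri> _ _ 0<b with b ℤ.<? + p
  ...   | yes b<p = inj₁ (0<b , b<p)
  ...   | no  b≮p rewrite branch-B-T₂ {b} {c} (ℤ.<⇒≤ 0<b) | ℤ.*-identityˡ b =
    inj₂ (inj₂ (∣move∣-< {b} {c} (p∤b h) (ℤ.≮⇒≥ b≮p)))
  B-attracted {b , c} h | tri< b<0 _ _
    rewrite branch-B-T₁ {b} {c} b<0 | ℤ.-1*i≡-i b with - b ℤ.<? + p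
  ... | yes -b<p = inj₂ (inj₁ (subst Small (sym (move-small { - b} {c} (ℤ.<⇒≤ 0<-b) -b<p)) (0<-b , -b<p)))
    where 0<-b = ℤ.neg-mono-< b<0
  ... | no  -b≮p = inj₂ (inj₂ (subst (abs (proj₁ (move (- b) c)) ℕ.<_) (ℤ.∣-i∣≡∣i∣ b)
    (∣move∣-< { - b} {c} (p∤b h ∘ ∣-b⇒∣b) (ℤ.≮⇒≥ -b≮p))))

  B-periodic⇒small : ∀ {s} → Hensel s → Periodic B s → Small s
  B-periodic⇒small = periodic-in B {Small} (λ {s} _ w → subst Small (sym (B-fixed {s} w)) w) B-attracted

  small⇒B-periodic : ∀ {s} → Small s → Periodic B s
  small⇒B-periodic {s} w = 1 , ℕ.≤-refl , B-fixed {s} w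

  -- Periodic points of Algorithm C

  -- P₁ (big), R₁ (small) and S₃ ∪ S₄ (negative).

  data Target : ℤ × ℤ → Set where
    negative : ∀ {b c} → c < 0ℤ → Target (b , c)
    small    : ∀ {b c} → 0ℤ < c → 0ℤ < b → b < + p → Target (b , c)
    big      : ∀ {b c} → 0ℤ < c → 0ℤ < b → + p ≤ b → c < b mod * (b - b mod) → Target (b , c)

  C-T₁ʳ : ∀ b {c} → c < 0ℤ → next C (b , c) ≡ move (- b) c
  C-T₁ʳ b {c} c<0 rewrite branch-C-T₁ʳ {b} c<0 | ℤ.-1*i≡-i b = refl

  C-T₁ˡ : ∀ {b} c → b < 0ℤ → next C (b , c) ≡ move (- b) c
  C-T₁ˡ {b} c b<0 rewrite branch-C-T₁ˡ {b} {c} b<0 | ℤ.-1*i≡-i b = refl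

  C-T₂ : ∀ {b c} → 0ℤ < b → 0ℤ < c → next C (b , c) ≡ move b c
  C-T₂ {b} {c} 0<b 0<c rewrite branch-C-T₂ {b} {c} (ℤ.<⇒≤ 0<b) 0<c | ℤ.*-identityˡ b = refl

  move-1-positive : ∀ {z c} → ¬ (+ p ∣ z) → z < 0ℤ → 0ℤ < proj₁ (move z c)
  move-1-positive p∤z z<0 = ℤ.+-mono-<-≤
    (ℤ.+-mono-<-≤ (0<mod p∤z) (ℤ.<⇒≤ (0<mod p∤z))) (ℤ.<⇒≤ (ℤ.neg-mono-< z<0))

  -- Here c′ = c + d (b′ - d) with d = b′ mod p, so c < 0 gives the bound on c′.

  move-negative : ∀ {z c} → ¬ (+ p ∣ z) → z < 0ℤ → c < 0ℤ →
                  proj₂ (move z c) ≢ 0ℤ → Target (move z c)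
  move-negative {z} {c} p∤z z<0 c<0 c′≢0 with ℤ.<-cmp (proj₂ (move z c)) 0ℤ
  ... | tri< c′<0 _ _ = negative c′<0
  ... | tri≈ _ c′≡0 _ = contradiction c′≡0 c′≢0
  ... | tri> _ _ 0<c′ with proj₁ (move z c) ℤ.<? + p
  ...   | yes b′<p = small 0<c′ (move-1-positive {z} {c} p∤z z<0) b′<p
  ...   | no b′≮p = big 0<c′ (move-1-positive {z} {c} p∤z z<0) (ℤ.≮⇒≥ b′≮p)
    (subst (λ d → proj₂ (move z c) < d * (proj₁ (move z c) - d)) (sym (next-mod z))
      (0<-via (ℤ.neg-mono-< c<0) (rearrange c (z mod) z)))
    where
    rearrange : ∀ c d z → - c ≡ d * (((d + d) - z) - d) - (c + d * (d - z))
    rearrange = solve-∀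

  -- The residue d of z is at most z, so d (d - z) ≤ 0 and the constant coefficient stays negative.
  move-positive : ∀ {z c} → 0ℤ < z → c < 0ℤ → Target (move z c)
  move-positive {z} {c} 0<z c<0 = negative (ℤ.+-mono-<-≤ c<0
    (subst (z mod * (z mod - z) ≤_) (ℤ.*-zeroʳ (z mod))
      (ℤ.*-monoˡ-≤-nonNeg (z mod) (ℤ.i≤j⇒i-j≤0 (%p-≤ (ℤ.<⇒≤ 0<z))))))

  -- The inequality that defines `P₁` says precisely that the next constant coefficient is negative.
  move-big : ∀ {b c} → c < b mod * (b - b mod) → proj₂ (move b c) < 0ℤ
  move-big {b} {c} c<d[b-d] = 0<-via (<⇒0< c<d[b-d]) (rearrange c (b mod) b)
    where
    rearrange : ∀ c d b → d * (b - d) - c ≡ 0ℤ - (c + d * (d - b))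
    rearrange = solve-∀

  C-small-fixed : ∀ {b c} → 0ℤ < c → 0ℤ < b → b < + p → next C (b , c) ≡ (b , c)
  C-small-fixed 0<c 0<b b<p = trans (C-T₂ 0<b 0<c) (move-small (ℤ.<⇒≤ 0<b) b<p)

  C-closed : ∀ {s} → Hensel s → Target s → Target (next C s)
  C-closed {b , c} h (negative c<0) = subst Target (sym (C-T₁ʳ b {c} c<0)) target
    where
    -- A vanishing constant coefficient would give the next polynomial the root 0.
    c′≢0 : proj₂ (move (- b) c) ≢ 0ℤ
    c′≢0 = subst (λ s → proj₂ s ≢ 0ℤ) (C-T₁ʳ b {c} c<0) (NoRoot⇒c≢0 (noRoot (next-Hensel C {b , c} h)))
    target : Target (move (- b) c)
    target with ℤ.<-cmp b 0ℤ
    ... | tri< b<0 _ _ = move-positive (ℤ.neg-mono-< b<0) c<0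
    ... | tri≈ _ b≡0 _ = contradiction b≡0 (p∤⇒≢0 (p∤b h))
    ... | tri> _ _ 0<b = move-negative (p∤b h ∘ ∣-b⇒∣b) (ℤ.neg-mono-< 0<b) c<0 c′≢0
  C-closed h (small 0<c 0<b b<p) =
    subst Target (sym (C-small-fixed 0<c 0<b b<p)) (small 0<c 0<b b<p)
  C-closed {b , c} h (big 0<c 0<b p≤b c<) =
    subst Target (sym (C-T₂ 0<b 0<c)) (negative (move-big {b} c<))

  -- All pairs with c < 0 are targets, so only c > 0 is left. There the branch depends on the sign
  -- of b alone, and the argument for B applies.
  C-attracted : ∀ {s} → Hensel s →
    Target s ⊎ Target (next C s) ⊎ abs (proj₁ (next C s)) ℕ.< abs (proj₁ s)
  C-attracted {b , c} h with ℤ.<-cmp c 0ℤ | ℤ.<-cmp b 0ℤ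
  ... | tri< c<0 _ _ | _            = inj₁ (negative c<0)
  ... | tri≈ _ c≡0 _ | _            = contradiction c≡0 (NoRoot⇒c≢0 (noRoot h))
  ... | tri> _ _ 0<c | tri≈ _ b≡0 _ = contradiction b≡0 (p∤⇒≢0 (p∤b h))
  ... | tri> _ _ 0<c | tri> _ _ 0<b with b ℤ.<? + p
  ...   | yes b<p = inj₁ (small 0<c 0<b b<p)
  ...   | no  b≮p =
    inj₂ (inj₂ (subst (λ s → abs (proj₁ s) ℕ.< abs b) (sym (C-T₂ 0<b 0<c))
      (∣move∣-< {b} {c} (p∤b h) (ℤ.≮⇒≥ b≮p))))
  C-attracted {b , c} h | tri> _ _ 0<c | tri< b<0 _ _ with - b ℤ.<? + p
  ... | yes -b<p = inj₂ (inj₁ (subst Target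
    (sym (trans (C-T₁ˡ c b<0) (move-small { - b} {c} (ℤ.<⇒≤ 0<-b) -b<p))) (small 0<c 0<-b -b<p)))
    where 0<-b = ℤ.neg-mono-< b<0
  ... | no  -b≮p = inj₂ (inj₂ (subst (λ s → abs (proj₁ s) ℕ.< abs b) (sym (C-T₁ˡ c b<0))
    (subst (abs (proj₁ (move (- b) c)) ℕ.<_) (ℤ.∣-i∣≡∣i∣ b)
      (∣move∣-< { - b} {c} (p∤b h ∘ ∣-b⇒∣b) (ℤ.≮⇒≥ -b≮p)))))

  C-periodic⇒target : ∀ {s} → Hensel s → Periodic C s → Target s
  C-periodic⇒target = periodic-in C {Target} C-closed C-attracted

  -- The digit d can be read off the image by `next-mod`; then z = 2d - b′ and c = c′ + d² - b′ d
  -- for the image (b′ , c′).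
  move-injective : ∀ y z {c e} → move y c ≡ move z e → y ≡ z × c ≡ e
  move-injective y z {c} {e} eq =
    trans (sym (unmove₁ (y mod) y)) (trans (cong₂ (λ d b → (d + d) - b) d≡ (cong proj₁ eq)) (unmove₁ (z mod) z)) ,
    trans (sym (unmove₂ (y mod) y c)) (trans (trans
      (cong (λ d → (proj₂ (move y c) + d * d) - proj₁ (move y c) * d) d≡)
      (cong (λ s → (proj₂ s + z mod * z mod) - proj₁ s * z mod) eq))
      (unmove₂ (z mod) z e))
    where
    d≡ : y mod ≡ z mod
    d≡ = trans (sym (next-mod y)) (trans (cong _mod (cong proj₁ eq)) (next-mod z))
    unmove₁ : ∀ d z → (d + d) - ((d + d) - z) ≡ z
    unmove₁ = solve-∀
    unmove₂ : ∀ d z c → ((c + d * (d - z)) + d * d) - ((d + d) - z) * d ≡ c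
    unmove₂ = solve-∀

  -- A target with c > 0 also has b > 0, so on targets the sign of c alone decides the branch.
  data Sign (s : ℤ × ℤ) : Set where
    T₁-negative : proj₂ s < 0ℤ → next C s ≡ move (- proj₁ s) (proj₂ s) → Sign s
    T₂-positive : 0ℤ < proj₂ s → next C s ≡ move (proj₁ s) (proj₂ s) → Sign s

  sign : ∀ {s} → Target s → Sign s
  sign {b , c} (negative c<0)      = T₁-negative c<0 (C-T₁ʳ b {c} c<0)
  sign {b , c} (small 0<c 0<b _)   = T₂-positive 0<c (C-T₂ 0<b 0<c)
  sign {b , c} (big 0<c 0<b _ _)   = T₂-positive 0<c (C-T₂ 0<b 0<c)

  -- Since `move` remembers c and the sign of c tells the branch, targets with equal images cannot
  -- have used different branches.
  C-injective : ∀ {s t} → Target s → Target t → next C s ≡ next C t → s ≡ t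
  C-injective {b , c} {b′ , c′} ws wt eq with sign ws | sign wt
  ... | T₁-negative _ e | T₁-negative _ f
      = let b≡ , c≡ = move-injective (- b) (- b′) (trans (sym e) (trans eq f))
        in cong₂ _,_ (ℤ.neg-injective b≡) c≡
  ... | T₂-positive _ e | T₂-positive _ f
      = let b≡ , c≡ = move-injective b b′ (trans (sym e) (trans eq f)) in cong₂ _,_ b≡ c≡
  ... | T₁-negative c<0 e | T₂-positive 0<c′ f
      = contradiction (subst (_< 0ℤ) (proj₂ (move-injective (- b) b′ (trans (sym e) (trans eq f)))) c<0)
                      (ℤ.<-asym 0<c′)
  ... | T₂-positive 0<c e | T₁-negative c′<0 f
      = contradiction (subst (0ℤ <_) (proj₂ (move-injective b (- b′) (trans (sym e) (trans eq f)))) 0<c)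
                      (ℤ.<-asym c′<0)

  discriminant : ℤ × ℤ → ℤ
  discriminant (b , c) = b * b - + 4 * c

  -- The new polynomial is X² - zX + c translated by d, and translation preserves the discriminant.
  move-discriminant : ∀ z c → discriminant (move z c) ≡ discriminant (z , c)
  move-discriminant z c = identity (z mod) z c
    where
    identity : ∀ d z c → ((d + d) - z) * ((d + d) - z) - + 4 * (c + d * (d - z)) ≡ z * z - + 4 * c
    identity = solve-∀

  C-discriminant : ∀ {s} → Target s → discriminant (next C s) ≡ discriminant s
  C-discriminant {b , c} w with sign w
  ... | T₁-negative _ e = trans (cong discriminant e) (trans (move-discriminant (- b) c) (even b c))
    where
    even : ∀ b c → - b * - b - + 4 * c ≡ b * b - + 4 * c
    even = solve-∀
  ... | T₂-positive _ e = trans (cong discriminant e) (move-discriminant b c)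

  -- With c < 0 the discriminant D satisfies |b| ≤ b² ≤ b² - 4c = D.
  negative-bound : ∀ {b c} → c < 0ℤ → abs b ℕ.≤ abs (discriminant (b , c))
  negative-bound {b} {c} c<0 = ℕ.≤-trans (m≤m*m (abs b)) (subst (ℕ._≤ abs (discriminant (b , c)))
    (ℤ.abs-* b b) (∣∣-mono-≤ (square≥0 b) b²≤D))
    where
    m≤m*m : ∀ m → m ℕ.≤ m ℕ.* m
    m≤m*m zero    = z≤n
    m≤m*m (suc m) = ℕ.m≤m*n (suc m) (suc m)
    square≥0 : ∀ i → 0ℤ ≤ i * i
    square≥0 (+ zero)  = +≤+ z≤n
    square≥0 (+ suc n) = +≤+ z≤n
    square≥0 -[1+ n ]  = +≤+ z≤n
    ∣∣-mono-≤ : ∀ {i j} → 0ℤ ≤ i → i ≤ j → abs i ℕ.≤ abs j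
    ∣∣-mono-≤ {+ _} {+ _} _ (+≤+ m≤n) = m≤n
    identity : ∀ b c → + 4 * (- c) ≡ (b * b - + 4 * c) - b * b
    identity = solve-∀
    b²≤D : b * b ≤ b * b - + 4 * c
    b²≤D = ℤ.<⇒≤ (0<-via (0<* {+ 4} (+<+ (s≤s z≤n)) (ℤ.neg-mono-< c<0)) (identity b c))

  -- A big state is followed by a negative one of the same discriminant.

  C-bound : ∀ {s} → Target s → abs (proj₁ s) ℕ.≤ (p ℕ.+ p) ℕ.+ abs (discriminant s)
  C-bound {b , c} (negative c<0) = ℕ.m≤n⇒m≤o+n (p ℕ.+ p) (negative-bound {b} {c} c<0)
  C-bound {+ b , c} (small _ _ (+<+ b<p)) =
    ℕ.m≤n⇒m≤n+o _ (ℕ.m≤n⇒m≤n+o p (ℕ.<⇒≤ b<p))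
  C-bound {b , c} (big _ _ _ c<) = subst (ℕ._≤ (p ℕ.+ p) ℕ.+ abs (discriminant (b , c)))
    (cong abs (unmove (b mod) b))
    (ℕ.≤-trans (ℤ.∣i-j∣≤∣i∣+∣j∣ (b mod + b mod) b′)
      (ℕ.+-mono-≤ (ℕ.+-mono-≤ (ℕ.<⇒≤ (n%ℕd<d b p)) (ℕ.<⇒≤ (n%ℕd<d b p)))
        (subst (λ D → abs b′ ℕ.≤ abs D) (move-discriminant b c)
          (negative-bound {b′} {c′} (move-big {b} c<)))))
    where
    b′ = proj₁ (move b c)
    c′ = proj₂ (move b c)
    unmove : ∀ d z → (d + d) - ((d + d) - z) ≡ z
    unmove = solve-∀

  -- Along the trajectory D is constant, |b| is bounded in terms of D, and b together with D
  -- determines c. So two states coincide, and injectivity peels off their common steps until the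
  -- initial state itself recurs.
  target⇒C-periodic : ∀ {s} → Hensel s → Target s → Periodic C s
  target⇒C-periodic {s} h w = m , 1≤m , sym (cancel (toℕ i) (trans sᵢ≡sⱼ (cong (trajectory C s) (sym i+m≡j))))
    where
    target : ∀ n → Target (trajectory C s n)
    target zero    = w
    target (suc n) = C-closed (trajectory-Hensel C h n) (target n)

    same-discriminant : ∀ n → discriminant (trajectory C s n) ≡ discriminant s
    same-discriminant zero    = refl
    same-discriminant (suc n) = trans (C-discriminant (target n)) (same-discriminant n)

    N = (p ℕ.+ p) ℕ.+ abs (discriminant s)

    bounded : ∀ n → abs (proj₁ (trajectory C s n)) ℕ.≤ N
    bounded n = subst (λ D → abs (proj₁ (trajectory C s n)) ℕ.≤ (p ℕ.+ p) ℕ.+ abs D)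
      (same-discriminant n) (C-bound (target n))

    -- As |b| ≤ N, the sum b + N lies between 0 and 2N, and taking its absolute value loses nothing.
    code : ∀ n → Fin (suc (N ℕ.+ N))
    code n = fromℕ< {abs (proj₁ (trajectory C s n) + + N)}
      (s≤s (ℕ.≤-trans (ℤ.∣i+j∣≤∣i∣+∣j∣ (proj₁ (trajectory C s n)) (+ N)) (ℕ.+-monoˡ-≤ N (bounded n))))

    shift-injective : ∀ {b b′} → abs b ℕ.≤ N → abs b′ ℕ.≤ N → abs (b + + N) ≡ abs (b′ + + N) → b ≡ b′
    shift-injective {b} {b′} ∣b∣≤N ∣b′∣≤N eq = trans (sym (unshift b (+ N)))
      (trans (cong (_- + N) (trans (sym (ℤ.0≤i⇒+∣i∣≡i (nonneg b ∣b∣≤N)))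
        (trans (cong +_ eq) (ℤ.0≤i⇒+∣i∣≡i (nonneg b′ ∣b′∣≤N))))) (unshift b′ (+ N)))
      where
      unshift : ∀ b n → (b + n) - n ≡ b
      unshift = solve-∀
      nonneg : ∀ b → abs b ℕ.≤ N → 0ℤ ≤ b + + N
      nonneg (+ n)    _     = +≤+ z≤n
      nonneg -[1+ n ] 1+n≤N = subst (0ℤ ≤_) (sym (ℤ.⊖-≥ 1+n≤N)) (+≤+ z≤n)

    determined : ∀ {s t} → proj₁ s ≡ proj₁ t → discriminant s ≡ discriminant t → s ≡ t
    determined {b , c} {.b , c′} refl eq = cong (b ,_) (ℤ.*-cancelˡ-≡ (+ 4) c c′
      (trans (sym (solve₄ b c)) (trans (cong (λ D → b * b - D) eq) (solve₄ b c′))))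
      where
      solve₄ : ∀ b c → b * b - (b * b - + 4 * c) ≡ + 4 * c
      solve₄ = solve-∀

    collision = Fin.pigeonhole (ℕ.n<1+n (suc (N ℕ.+ N))) (code ∘ toℕ)
    i = proj₁ collision
    j = proj₁ (proj₂ collision)
    i<j = proj₁ (proj₂ (proj₂ collision))
    code≡ = proj₂ (proj₂ (proj₂ collision))
    m = toℕ j ℕ.∸ toℕ i

    i+m≡j : toℕ i ℕ.+ m ≡ toℕ j
    i+m≡j = ℕ.m+[n∸m]≡n (ℕ.<⇒≤ i<j)

    1≤m : 1 ℕ.≤ m
    1≤m = ℕ.m<n⇒0<n∸m i<j

    sᵢ≡sⱼ : trajectory C s (toℕ i) ≡ trajectory C s (toℕ j)
    sᵢ≡sⱼ = determined
      (shift-injective (bounded (toℕ i)) (bounded (toℕ j))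
        (trans (sym (Fin.toℕ-fromℕ< _)) (trans (cong toℕ code≡) (Fin.toℕ-fromℕ< _))))
      (trans (same-discriminant (toℕ i)) (sym (same-discriminant (toℕ j))))

    cancel : ∀ n → trajectory C s n ≡ trajectory C s (n ℕ.+ m) → s ≡ trajectory C s m
    cancel zero    eq = eq
    cancel (suc n) eq = cancel n (C-injective (target n) (target (n ℕ.+ m)) eq)

  -- p-adic integers

  p^-nonZero : ∀ n → ℤ.NonZero (p^ n)
  p^-nonZero n = ℤ.≢-nonZero (λ eq → ℕ.≢-nonZero⁻¹ (p ℕ.^ n) {{ℕ.m^n≢0 p n}} (ℤ.+-injective eq))

  p^-+ : ∀ m n → p^ (m ℕ.+ n) ≡ p^ m * p^ n
  p^-+ m n = trans (cong +_ (ℕ.^-distribˡ-+-* p m n)) (ℤ.pos-* (p ℕ.^ m) (p ℕ.^ n))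

  p^-suc : ∀ n → p^ (suc n) ≡ + p * p^ n
  p^-suc n = ℤ.pos-* p (p ℕ.^ n)

  p^1≡p : p^ 1 ≡ + p
  p^1≡p = cong +_ (ℕ.*-identityʳ p)

  private instance
    p-nonZero : ℤ.NonZero (+ p)
    p-nonZero = subst ℤ.NonZero p^1≡p (p^-nonZero 1)

  p^∣p^ : ∀ {m n} → m ℕ.≤ n → p^ m ∣ p^ n
  p^∣p^ {m} m≤n with k , refl ← ℕ.m≤n⇒∃[o]m+o≡n m≤n = divides (p^ k)
    (trans (p^-+ m k) (ℤ.*-comm (p^ m) (p^ k)))

  p^∣-≤ : ∀ {m n z} → m ℕ.≤ n → p^ n ∣ z → p^ m ∣ z
  p^∣-≤ m≤n = ∣-trans (p^∣p^ m≤n)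

  p^0∣ : ∀ z → p^ 0 ∣ z
  p^0∣ z = divides z (sym (ℤ.*-identityʳ z))

  p∣⇒p^1∣ : ∀ {z} → + p ∣ z → p^ 1 ∣ z
  p∣⇒p^1∣ {z} = subst (_∣ z) (sym p^1≡p)

  p^1+n∣⇒p∣ : ∀ {n z} → p^ (suc n) ∣ z → + p ∣ z
  p^1+n∣⇒p∣ {n} {z} = subst (_∣ z) p^1≡p ∘ p^∣-≤ {1} {suc n} {z} (s≤s z≤n)

  p^-cancel-unit : ∀ {x} → ¬ (+ p ∣ x) → ∀ n {z} → p^ n ∣ x * z → p^ n ∣ z
  p^-cancel-unit         p∤x zero    {z} _ = p^0∣ z
  p^-cancel-unit {x} p∤x (suc n) {z} p^∣xz with ∣-or-∣ x z (p^1+n∣⇒p∣ {n} p^∣xz)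
  ... | inj₁ p∣x = contradiction p∣x p∤x
  ... | inj₂ (divides q refl) = subst₂ _∣_ (sym (p^-suc n)) (ℤ.*-comm (+ p) q)
    (*-monoʳ-∣ (+ p) (p^-cancel-unit {x} p∤x n
      (*-cancelˡ-∣ (+ p) (subst₂ _∣_ (p^-suc n) (rearrange x q (+ p)) p^∣xz))))
    where
    rearrange : ∀ x q p → x * (q * p) ≡ p * (x * q)
    rearrange = solve-∀

  -- The factor x contains at most k factors p, and removing each of them costs one power.
  p^-cancel : ∀ k {n x z} → ¬ (p^ (suc k) ∣ x) → p^ (n ℕ.+ k) ∣ x * z → p^ n ∣ z
  p^-cancel zero {n} {x} {z} p∤x p^∣xz = p^-cancel-unit (p∤x ∘ p∣⇒p^1∣) n
    (subst (λ n → p^ n ∣ x * z) (ℕ.+-identityʳ n) p^∣xz)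
  p^-cancel (suc k) {n} {x} {z} p^∤x p^∣xz with + p ∣? x
  ... | no p∤x = p^∣-≤ (ℕ.m≤m+n n (suc k)) (p^-cancel-unit p∤x (n ℕ.+ suc k) p^∣xz)
  ... | yes (divides q refl) = p^-cancel k {n} {q} {z}
    (λ p^∣q → p^∤x (subst₂ _∣_ (sym (p^-suc (suc k))) (ℤ.*-comm (+ p) q) (*-monoʳ-∣ (+ p) p^∣q)))
    (*-cancelˡ-∣ (+ p) (subst₂ _∣_ (trans (cong p^ (ℕ.+-suc n k)) (p^-suc (n ℕ.+ k))) (rearrange q z (+ p)) p^∣xz))
    where
    rearrange : ∀ q z p → (q * p) * z ≡ p * (q * z)
    rearrange = solve-∀

  1<p : 1 ℕ.< p
  1<p = ℕ.nonTrivial⇒n>1 p {{prime⇒nonTrivial p-prime}}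

  n<p^n : ∀ n → n ℕ.< p ℕ.^ n
  n<p^n zero    = s≤s z≤n
  n<p^n (suc n) = ℕ.≤-<-trans (n<p^n n) (ℕ.^-monoʳ-< p 1<p (ℕ.n<1+n n))

  -- The power of p with exponent |z| already exceeds |z|.
  p^∣⇒≡0 : ∀ {z} → (∀ n → p^ n ∣ z) → z ≡ 0ℤ
  p^∣⇒≡0 {z} p^∣z = ℤ.∣i∣≡0⇒i≡0 (m∣n∧n<m⇒n≡0 (∣⇒∣ᵤ (p^∣z (abs z))) (n<p^n (abs z)))

  approx-+ : ∀ x m k → p^ k ∣ approx x (m ℕ.+ k) - approx x k
  approx-+ x zero    k = divides 0ℤ (ℤ.+-inverseʳ (approx x k))
  approx-+ x (suc m) k = ∣-respʳ
    (ℤ.+-minus-telescope (approx x (suc m ℕ.+ k)) (approx x (m ℕ.+ k)) (approx x k))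
    (∣m∣n⇒∣m+n (p^∣-≤ (ℕ.m≤n+m k m) (coherent x (m ℕ.+ k))) (approx-+ x m k))

  approx-≥ : ∀ x {k n} → k ℕ.≤ n → p^ k ∣ approx x n - approx x k
  approx-≥ x {k} {n} k≤n = subst (λ n → p^ k ∣ approx x n - approx x k) (ℕ.m∸n+n≡m k≤n)
    (approx-+ x (n ℕ.∸ k) k)

  ∣-transfer : ∀ {m a b} → m ∣ a - b → m ∣ b → m ∣ a
  ∣-transfer {m} {a} {b} m∣a-b m∣b = ∣-respʳ (cancel a b) (∣m∣n⇒∣m+n m∣a-b m∣b)
    where
    cancel : ∀ a b → (a - b) + b ≡ a
    cancel = solve-∀

  ∣-swap : ∀ {m} a b → m ∣ a - b → m ∣ b - a
  ∣-swap a b m∣a-b = ∣-respʳ (swap a b) (∣m⇒∣-m m∣a-b)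
    where
    swap : ∀ a b → - (a - b) ≡ b - a
    swap = solve-∀

  approx-down : ∀ x {k n} → k ℕ.≤ n → p^ k ∣ approx x n → p^ k ∣ approx x k
  approx-down x k≤n = ∣-transfer (∣-swap (approx x _) (approx x _) (approx-≥ x k≤n))

  ∈p^⇒∣ : ∀ {x k n} → x ∈p^ k → k ℕ.≤ n → p^ k ∣ approx x n
  ∈p^⇒∣ {x} {k} {n} (w , x≈p^kw) k≤n =
    ∣-transfer (p^∣-≤ k≤n (x≈p^kw n)) (∣m⇒∣m*n (approx w n) ∣-refl)

  ∣⇒∈p^ : ∀ x {k n} → k ℕ.≤ n → p^ k ∣ approx x n → x ∈p^ k
  ∣⇒∈p^ x {k} {n} k≤n p^∣x = w , λ m → ∣-swap (p^ k * approx w m) (approx x m)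
      (∣-respʳ (cong (_- approx x m) (w-spec m))
        (subst (λ j → p^ m ∣ approx x j - approx x m) (ℕ.+-comm k m) (approx-+ x k m)))
    where
    instance _ = p^-nonZero k
    p^∣approx : ∀ m → p^ k ∣ approx x (m ℕ.+ k)
    p^∣approx m = ∣-transfer (approx-+ x m k) (approx-down x k≤n p^∣x)
    w-spec : ∀ m → approx x (m ℕ.+ k) ≡ p^ k * quotient (p^∣approx m)
    w-spec m = trans (_∣_.equality (p^∣approx m)) (ℤ.*-comm (quotient (p^∣approx m)) (p^ k))
    -- Division by pᵏ costs k digits of precision, so level m of w comes from level m + k of x.
    w : ℤₚ
    w = record
      { approx   = λ m → quotient (p^∣approx m)
      ; coherent = λ m → *-cancelˡ-∣ (p^ k) (subst₂ _∣_
          (trans (p^-+ m k) (ℤ.*-comm (p^ m) (p^ k)))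
          (trans (cong₂ _-_ (w-spec (suc m)) (w-spec m))
                 (distrib (p^ k) (quotient (p^∣approx (suc m))) (quotient (p^∣approx m))))
          (coherent x (m ℕ.+ k)))
      }
      where
      distrib : ∀ a b c → a * b - a * c ≡ a * (b - c)
      distrib = solve-∀

  Vanishes : ℤₚ → Set
  Vanishes x = ∀ n → p^ n ∣ approx x n

  vanishes⇒≈0 : ∀ {x} → Vanishes x → x ≈ ⟪ 0ℤ ⟫
  vanishes⇒≈0 {x} v n = ∣-respʳ (sym (ℤ.+-identityʳ (approx x n))) (v n)

  ≈0⇒vanishes : ∀ {x} → x ≈ ⟪ 0ℤ ⟫ → Vanishes x
  ≈0⇒vanishes {x} x≈0 n = ∣-respʳ (ℤ.+-identityʳ (approx x n)) (x≈0 n)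

  valuation-cancel : ∀ {x k} → HasValuation x k → ∀ z → Vanishes (x ⊗ z) → Vanishes z
  valuation-cancel {x} {k} (_ , x∉p^1+k) z xz≈0 n =
    approx-down z n≤m (p^-cancel k {n} {approx x m}
      (x∉p^1+k ∘ ∣⇒∈p^ x (s≤s (ℕ.m≤n+m k n)))
      (p^∣-≤ (ℕ.n≤1+n (n ℕ.+ k)) (xz≈0 m)))
    where
    -- At level n + k + 1 it is visible that p^(k + 1) does not divide x, and enough precision is
    -- left after the loss of k powers.
    m = suc (n ℕ.+ k)
    n≤m : n ℕ.≤ m
    n≤m = ℕ.m≤n⇒m≤1+n (ℕ.m≤m+n n k)

  unit-cancel : ∀ x → ¬ (+ p ∣ approx x 1) → ∀ z → Vanishes (x ⊗ z) → Vanishes z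
  unit-cancel x p∤x z xz≈0 zero    = p^0∣ (approx z 0)
  unit-cancel x p∤x z xz≈0 (suc n) = p^-cancel-unit (p∤x ∘ p∣x) (suc n) (xz≈0 (suc n))
    where
    p∣x : + p ∣ approx x (suc n) → + p ∣ approx x 1
    p∣x p∣xₙ = p^1+n∣⇒p∣ {0} (approx-down x (s≤s z≤n) (p∣⇒p^1∣ p∣xₙ))

  p∣approx : ∀ x → x ∈p^ 1 → ∀ n → + p ∣ approx x (suc n)
  p∣approx x x∈p n = p^1+n∣⇒p∣ {0} (∈p^⇒∣ {x} x∈p (s≤s z≤n))

  -- c + x (b + x a), in the shape taken by eval; the value a = 0 covers the
  -- minimal polynomials of rational elements.

  IsRoot : (a b c : ℤ) → ℤₚ → Set
  IsRoot a b c x = Vanishes (⟪ c ⟫ ⊕ x ⊗ (⟪ b ⟫ ⊕ x ⊗ ⟪ a ⟫))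

  quadratic-coefficient : Coefficients → ℤ
  quadratic-coefficient (quadratic a b c) = a
  quadratic-coefficient (rational b c)    = 0ℤ

  eval-quadratic : ∀ {a b c x} → eval (c ∷ b ∷ a ∷ []) x ≈ ⟪ 0ℤ ⟫ → IsRoot a b c x
  eval-quadratic {a} {b} {c} {x} root n = ∣-respʳ (simplify a b c (approx x n)) (root n)
    where
    simplify : ∀ a b c x → (c + x * (b + x * (a + x * 0ℤ))) - 0ℤ ≡ c + x * (b + x * a)
    simplify = solve-∀

  quadratic-eval : ∀ {a b c x} → IsRoot a b c x → eval (c ∷ b ∷ a ∷ []) x ≈ ⟪ 0ℤ ⟫
  quadratic-eval {a} {b} {c} {x} root n = ∣-respʳ (simplify a b c (approx x n)) (root n)
    where
    simplify : ∀ a b c x → c + x * (b + x * a) ≡ (c + x * (b + x * (a + x * 0ℤ))) - 0ℤ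
    simplify = solve-∀

  -- Minimal polynomials

  minPoly-root : ∀ {x} m → IsMinimalPolynomial x m →
                 IsRoot (quadratic-coefficient m) (linear m) (constant m) x
  minPoly-root {x} (quadratic a b c) isMin = eval-quadratic {a} {b} {c} {x} (IsMinimalPolynomial.root isMin)
  minPoly-root {x} (rational b c)    isMin = ≈0⇒vanishes {⟪ c ⟫ ⊕ x ⊗ (⟪ b ⟫ ⊕ x ⊗ ⟪ 0ℤ ⟫)} (IsMinimalPolynomial.root isMin)

  no-linear-relation : ∀ {x a b c} → IsMinimalPolynomial x (quadratic a b c) →
                       ∀ {m n} → IsRoot 0ℤ n m x → m ≡ 0ℤ × n ≡ 0ℤ
  no-linear-relation {x} isMin {m} {n} root = zero-coefficients 0 , zero-coefficients 1
    where
    zero-coefficients = IsMinimalPolynomial.minimal isMin (m ∷ n ∷ []) (s≤s (s≤s (s≤s z≤n)))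
      (vanishes⇒≈0 {eval (m ∷ n ∷ []) x} root)

  -- Subtracting a′ times the minimal polynomial from a times the other one removes X²; what remains
  -- is linear and vanishes at x, so it is zero.
  quadratic-proportional : ∀ {x a b c} → IsMinimalPolynomial x (quadratic a b c) →
    ∀ {a′ b′ c′} → IsRoot a′ b′ c′ x → a * c′ ≡ a′ * c × a * b′ ≡ a′ * b
  quadratic-proportional {x} {a} {b} {c} isMin {a′} {b′} {c′} root =
    ℤ.i-j≡0⇒i≡j _ _ (proj₁ zeros) , ℤ.i-j≡0⇒i≡j _ _ (proj₂ zeros)
    where
    eliminate : ∀ a b c a′ b′ c′ x →
      a * (c′ + x * (b′ + x * a′)) + - a′ * (c + x * (b + x * a)) ≡
      (a * c′ - a′ * c) + x * ((a * b′ - a′ * b) + x * 0ℤ)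
    eliminate = solve-∀
    zeros = no-linear-relation isMin {a * c′ - a′ * c} {a * b′ - a′ * b} λ n →
      ∣-respʳ (eliminate a b c a′ b′ c′ (approx x n))
        (∣m∣n⇒∣m+n (∣n⇒∣m*n a (root n)) (∣n⇒∣m*n (- a′) (minPoly-root (quadratic a b c) isMin n)))

  positive-unit : ∀ {z} → 0ℤ < z → z ∣ 1ℤ → z ≡ 1ℤ
  positive-unit {+ suc n} _ z∣1 = cong +_ (ℕ.∣1⇒≡1 (∣⇒∣ᵤ z∣1))
  positive-unit {+ zero} (+<+ ()) _

  -- By proportionality a divides all coefficients of the minimal polynomial; coprimality and
  -- positivity then force a = 1.
  monic-unique : ∀ {x a b c} → IsMinimalPolynomial x (quadratic a b c) →
    ∀ {b′ c′} → IsRoot 1ℤ b′ c′ x → a ≡ 1ℤ × b ≡ b′ × c ≡ c′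
  monic-unique {x} {a} {b} {c} isMin {b′} {c′} root = a≡1 ,
    trans (sym ab′≡b) (trans (cong (_* b′) a≡1) (ℤ.*-identityˡ b′)) ,
    trans (sym ac′≡c) (trans (cong (_* c′) a≡1) (ℤ.*-identityˡ c′))
    where
    proportional = quadratic-proportional isMin {1ℤ} {b′} {c′} root
    ac′≡c : a * c′ ≡ c
    ac′≡c = trans (proj₁ proportional) (ℤ.*-identityˡ c)
    ab′≡b : a * b′ ≡ b
    ab′≡b = trans (proj₂ proportional) (ℤ.*-identityˡ b)
    a≡1 = positive-unit (IsMinimalPolynomial.positive isMin) (IsMinimalPolynomial.coprime isMin a
      (∣-respʳ ac′≡c (∣m⇒∣m*n c′ ∣-refl) ∷ ∣-respʳ ab′≡b (∣m⇒∣m*n b′ ∣-refl) ∷ ∣-refl ∷ []))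

  rational-unique : ∀ {x b c} → IsMinimalPolynomial x (rational b c) →
    ∀ {c′} → IsRoot 0ℤ 1ℤ c′ x → b ≡ 1ℤ × c ≡ c′
  rational-unique {x} {b} {c} isMin {c′} root = b≡1 ,
    trans (sym bc′≡c) (trans (cong (_* c′) b≡1) (ℤ.*-identityˡ c′))
    where
    eliminate : ∀ b c c′ x → b * (c′ + x * (1ℤ + x * 0ℤ)) + - 1ℤ * (c + x * (b + x * 0ℤ)) ≡
                             ((b * c′ - c) + x * 0ℤ)
    eliminate = solve-∀
    bc′≡c : b * c′ ≡ c
    bc′≡c = ℤ.i-j≡0⇒i≡j _ _ (IsMinimalPolynomial.minimal isMin ((b * c′ - c) ∷ []) (s≤s (s≤s z≤n))
      (vanishes⇒≈0 {eval ((b * c′ - c) ∷ []) x} λ n → ∣-respʳ (eliminate b c c′ (approx x n))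
        (∣m∣n⇒∣m+n (∣n⇒∣m*n b (root n)) (∣n⇒∣m*n (- 1ℤ) (minPoly-root (rational b c) isMin n)))) 0)
    b≡1 = positive-unit (IsMinimalPolynomial.positive isMin) (IsMinimalPolynomial.coprime isMin b
      (∣-respʳ bc′≡c (∣m⇒∣m*n c′ ∣-refl) ∷ ∣-refl ∷ []))

  p∣constant : ∀ {a b c x} → x ∈p^ 1 → IsRoot a b c x → + p ∣ c
  p∣constant {a} {b} {c} {x} x∈p root = ∣m+n∣n⇒∣m {m = c} (p^1+n∣⇒p∣ {0} (root 1))
    (∣m⇒∣m*n (b + approx x 1 * a) (p∣approx x x∈p 0))

  -- As x + r is a unit, the other factor would vanish and x would be the integer - s, against its
  -- degree 2.
  no-linear-factor : ∀ {x a b c} → IsMinimalPolynomial x (quadratic a b c) → ∀ r s →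
                     ¬ (+ p ∣ approx x 1 + r) → ¬ Vanishes ((x ⊕ ⟪ r ⟫) ⊗ (x ⊕ ⟪ s ⟫))
  no-linear-factor {x} isMin r s p∤x+r product≈0 = contradiction
    (proj₂ (no-linear-relation isMin {s} {1ℤ} λ n → ∣-respʳ (linear-form (approx x n) s)
      (unit-cancel (x ⊕ ⟪ r ⟫) p∤x+r (x ⊕ ⟪ s ⟫) product≈0 n)))
    λ ()
    where
    linear-form : ∀ x s → x + s ≡ s + x * (1ℤ + x * 0ℤ)
    linear-form = solve-∀

  -- For an integral root r the other root is - (b + r); as p ∤ b, only one of
  -- the two is divisible by p.

  minimal⇒noRoot : ∀ {x b c} → x ∈p^ 1 → ¬ (+ p ∣ b) → IsMinimalPolynomial x (quadratic 1ℤ b c) →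
                   NoRoot b c
  minimal⇒noRoot {x} {b} {c} x∈p p∤b isMin r r-root with + p ∣? r
  ... | yes p∣r = no-linear-factor isMin (b + r) (- r)
      (λ p∣x+b+r → p∤b (∣-respʳ (isolate (approx x 1) b r)
        (∣m∣n⇒∣m-n p∣x+b+r (∣m∣n⇒∣m+n (p∣approx x x∈p 0) p∣r))))
      (λ n → ∣-respʳ (factor (approx x n)) (minPoly-root (quadratic 1ℤ b c) isMin n))
    where
    isolate : ∀ x b r → (x + (b + r)) - (x + r) ≡ b
    isolate = solve-∀
    identity : ∀ b c r x → c + x * (b + x * 1ℤ) ≡ (x + (b + r)) * (x + - r) + (r * (r + b) + c)
    identity = solve-∀
    factor : ∀ x → c + x * (b + x * 1ℤ) ≡ (x + (b + r)) * (x + - r)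
    factor x = trans (identity b c r x)
      (trans (cong (_+_ ((x + (b + r)) * (x + - r))) r-root) (ℤ.+-identityʳ _))
  ... | no p∤r = no-linear-factor isMin (- r) (b + r)
      (λ p∣x-r → p∤r (∣-respʳ (isolate (approx x 1) r) (∣m∣n⇒∣m-n (p∣approx x x∈p 0) p∣x-r)))
      (λ n → ∣-respʳ (factor (approx x n)) (minPoly-root (quadratic 1ℤ b c) isMin n))
    where
    isolate : ∀ x r → x - (x + - r) ≡ r
    isolate = solve-∀
    identity : ∀ b c r x → c + x * (b + x * 1ℤ) ≡ (x + - r) * (x + (b + r)) + (r * (r + b) + c)
    identity = solve-∀
    factor : ∀ x → c + x * (b + x * 1ℤ) ≡ (x + - r) * (x + (b + r))
    factor x = trans (identity b c r x)
      (trans (cong (_+_ ((x + - r) * (x + (b + r)))) r-root) (ℤ.+-identityʳ _))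

  noRoot⇒minimal : ∀ {x b c} → x ∈p^ 1 → ¬ (+ p ∣ b) → NoRoot b c → IsRoot 1ℤ b c x →
                   IsMinimalPolynomial x (quadratic 1ℤ b c)
  noRoot⇒minimal {x} {b} {c} x∈p p∤b noRoot root = record
    { root     = quadratic-eval {1ℤ} {b} {c} {x} root
    ; minimal  = minimal
    ; positive = +<+ (s≤s z≤n)
    ; coprime  = λ where e (_ ∷ _ ∷ e∣1 ∷ []) → e∣1
    }
    where
    constant≡0 : ∀ {m n} → IsRoot 0ℤ n m x → n ≡ 0ℤ → m ≡ 0ℤ
    constant≡0 {m} lin refl = p^∣⇒≡0 λ n → ∣-respʳ (simplify m (approx x n)) (lin n)
      where
      simplify : ∀ m x → m + x * (0ℤ + x * 0ℤ) ≡ m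
      simplify = solve-∀

    -- The resultant of X² + bX + c and m + nX is an integer combination of two values that vanish
    -- at x. It is divisible by all powers of p, hence zero, and - m / n would be a rational root if
    -- n ≠ 0.
    linear≡0 : ∀ {m n} → IsRoot 0ℤ n m x → n ≡ 0ℤ
    linear≡0 {m} {n} lin = noRoot⇒noRationalRoot noRoot m n (p^∣⇒≡0 λ k →
      ∣-respʳ (resultant b c m n (approx x k))
        (∣m∣n⇒∣m+n (∣n⇒∣m*n (n * n) (root k)) (∣n⇒∣m*n (m - n * approx x k - b * n) (lin k))))
      where
      resultant : ∀ b c m n x →
        (n * n) * (c + x * (b + x * 1ℤ)) + (m - n * x - b * n) * (m + x * (n + x * 0ℤ)) ≡
        m * m - b * (m * n) + c * (n * n)
      resultant = solve-∀

    minimal : ∀ g → length g ℕ.< 3 → eval g x ≈ ⟪ 0ℤ ⟫ → g ≈ᴾ []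
    minimal [] _ _ _ = refl
    minimal (m ∷ []) _ gx≈0 = λ where
        zero    → constant≡0 {m} {0ℤ} (λ n → ∣-respʳ (pad m (approx x n)) (gx≈0 n)) refl
        (suc i) → refl
      where
      pad : ∀ m x → (m + x * 0ℤ) - 0ℤ ≡ m + x * (0ℤ + x * 0ℤ)
      pad = solve-∀
    minimal (m ∷ n ∷ []) _ gx≈0 = λ where
        zero          → constant≡0 {m} {n} lin (linear≡0 {m} {n} lin)
        (suc zero)    → linear≡0 {m} {n} lin
        (suc (suc i)) → refl
      where
      lin : IsRoot 0ℤ n m x
      lin = ≈0⇒vanishes {eval (m ∷ n ∷ []) x} gx≈0
    minimal (_ ∷ _ ∷ _ ∷ _) (s≤s (s≤s (s≤s ())))

  -- From expansions to coefficients

  signed-ε : ∀ br u → signed br u ≡ - (ε br * u)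
  signed-ε T₁ u = T₁-case u
    where
    T₁-case : ∀ u → u ≡ - (- 1ℤ * u)
    T₁-case = solve-∀
  signed-ε T₂ u = T₂-case u
    where
    T₂-case : ∀ u → - u ≡ - (1ℤ * u)
    T₂-case = solve-∀

  isMinimal : ∀ (x : Aₚ) {m} → minPoly x ≡ m → IsMinimalPolynomial (element x) m
  isMinimal x eq = subst (IsMinimalPolynomial (element x)) eq (Aₚ.isMinimalPolynomial x)

  root-of : ∀ (x : Aₚ) → IsRoot (quadratic-coefficient (minPoly x)) (Aₚ.b x) (Aₚ.c x) (element x)
  root-of x = minPoly-root (minPoly x) (Aₚ.isMinimalPolynomial x)

  positive-valuation : ∀ {x k} → x ∈p^ 1 → HasValuation x k → 1 ℕ.≤ k
  positive-valuation {k = zero}  x∈p (_ , x∉p) = contradiction x∈p x∉p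
  positive-valuation {k = suc _} _   _         = s≤s z≤n

  -- c = - x (b + x a) with b + x a a unit, so x and c have the same valuation.

  valuation-of-constant : ∀ {a b c x u j k} → x ∈p^ 1 → IsRoot a b c x → ¬ (+ p ∣ b) →
    c ≡ u * p^ j → ¬ (+ p ∣ u) → HasValuation x k → k ≡ j
  valuation-of-constant {a} {b} {c} {x} {u} {j} {k} x∈p root p∤b c≡upʲ p∤u (x∈pᵏ , x∉p¹⁺ᵏ)
    with ℕ.<-cmp k j
  ... | tri≈ _ k≡j _ = k≡j
  ... | tri< k<j _ _ = contradiction (∣⇒∈p^ x {suc k} {n} (s≤s (ℕ.m≤m+n k j))
      (p^-cancel-unit p∤E (suc k) (∣-respʳ (ℤ.*-comm X E)
        (∣m+n∣m⇒∣n {m = c} (p^∣-≤ (s≤s (ℕ.m≤m+n k j)) (root n)) p^∣c))))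
      x∉p¹⁺ᵏ
    where
    n = suc (k ℕ.+ j)
    X = approx x n
    E = b + X * a
    p∤E : ¬ (+ p ∣ E)
    p∤E p∣E = p∤b (∣m+n∣n⇒∣m {m = b} p∣E (∣m⇒∣m*n a (p∣approx x x∈p (k ℕ.+ j))))
    p^∣c : p^ (suc k) ∣ c
    p^∣c = subst (p^ (suc k) ∣_) (sym c≡upʲ) (∣n⇒∣m*n u (p^∣p^ k<j))
  ... | tri> _ _ j<k = contradiction (*-cancelˡ-∣ (p^ j) {{p^-nonZero j}} (subst₂ _∣_
        (trans (p^-suc j) (ℤ.*-comm (+ p) (p^ j))) (trans c≡upʲ (ℤ.*-comm u (p^ j))) p^∣c))
      p∤u
    where
    n = suc (k ℕ.+ j)
    X = approx x n
    p^∣c : p^ (suc j) ∣ c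
    p^∣c = ∣m+n∣n⇒∣m {m = c} (p^∣-≤ (s≤s (ℕ.m≤n+m j k)) (root n))
      (∣m⇒∣m*n (b + X * a) (p^∣-≤ j<k (∈p^⇒∣ {x} x∈pᵏ (ℕ.m≤n⇒m≤1+n (ℕ.m≤m+n k j)))))

  -- A step from x with a x² + b x + c = 0, where a = 0 for rational x.

  record Division (br : Branch) (a b c : ℤ) (x y : ℤₚ) (t : ℤ) (k d : ℕ) : Set where
    field
      x∈p         : x ∈p^ 1
      y∈p         : y ∈p^ 1
      root        : IsRoot a b c x
      u           : ℤ
      isUnitPart  : IsUnitPart c u
      numerator   : t ≡ signed br u
      valuation   : HasValuation x k
      d<p         : d ℕ.< p
      transformed : ∀ n → p^ n ∣ (approx y n + + d) * approx x n - t * p^ k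

  division : ∀ {alg m t k d} (x y : Aₚ) → minPoly x ≡ m → Step alg x t k d y →
    Division (branch alg (linear m) (constant m)) (quadratic-coefficient m) (linear m) (constant m)
             (element x) (element y) t k d
  division x y refl step = record
    { x∈p = Aₚ.element∈pℤₚ x ; y∈p = Aₚ.element∈pℤₚ y ; root = root-of x ; Step step }

  -- T(x) = ε (b + x a) - d, as t p^k / x = - ε c / x.

  division-linear : ∀ {br a b c x y t k d} → Division br a b c x y t k d → ¬ (+ p ∣ b) →
    ∀ n → p^ n ∣ (approx y n + + d) - ε br * (b + approx x n * a)
  division-linear {br} {a} {b} {c} {x} {y} {t} {k} {d} div p∤b n =
    ∣-respʳ (minus (approx y n + + d) (ε br) (b + approx x n * a))
      (valuation-cancel {x} {k} valuation z product≈0 n)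
    where
    open Division div
    minus : ∀ z e E → z + (- e) * E ≡ z - e * E
    minus = solve-∀
    z : ℤₚ
    z = (y ⊕ ⟪ + d ⟫) ⊕ ⟪ - ε br ⟫ ⊗ (⟪ b ⟫ ⊕ x ⊗ ⟪ a ⟫)
    j = proj₁ isUnitPart
    c≡upʲ = proj₁ (proj₂ isUnitPart)
    k≡j : k ≡ j
    k≡j = valuation-of-constant {a} {b} {c} {x} {u} {j} {k} x∈p root p∤b c≡upʲ
      (proj₂ (proj₂ isUnitPart)) valuation
    tpᵏ≡-εc : t * p^ k ≡ - (ε br * c)
    tpᵏ≡-εc = trans (cong₂ (λ t k → t * p^ k) (trans numerator (signed-ε br u)) k≡j)
      (trans (assoc (ε br) u (p^ j)) (cong (λ c → - (ε br * c)) (sym c≡upʲ)))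
      where
      assoc : ∀ e u q → - (e * u) * q ≡ - (e * (u * q))
      assoc = solve-∀
    combine : ∀ a b c e x z → (z * x - - (e * c)) + (- e) * (c + x * (b + x * a)) ≡
                              x * (z + (- e) * (b + x * a))
    combine = solve-∀
    product≈0 : Vanishes (x ⊗ z)
    product≈0 m = ∣-respʳ (combine a b c (ε br) (approx x m) (approx y m + + d))
      (∣m∣n⇒∣m+n (subst (λ w → p^ m ∣ (approx y m + + d) * approx x m - w) tpᵏ≡-εc (transformed m))
                 (∣n⇒∣m*n (- ε br) (root m)))

  -- Both x and T(x) lie in pℤₚ, so modulo p the formula T(x) = ε (b + xa) - d reduces to d ≡ ε b.
  division-digit : ∀ {br a b c x y t k d} → Division br a b c x y t k d → ¬ (+ p ∣ b) →
                   (ε br * b) mod ≡ + d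
  division-digit {br} {a} {b} {c} {x} {y} {t} {k} {d} div p∤b =
    cong +_ (residue-unique (ε br * b) d<p
      (∣-respʳ (isolate (approx y 1) (approx x 1) (+ d) (ε br) b a) (∣m∣n⇒∣m+n (∣m∣n⇒∣m-n
        (p^1+n∣⇒p∣ {0} (division-linear div p∤b 1)) (p∣approx y y∈p 0))
        (∣n⇒∣m*n (ε br * a) (p∣approx x x∈p 0)))))
    where
    open Division div
    isolate : ∀ y x d e b a → (((y + d) - e * (b + x * a)) - y) + (e * a) * x ≡ d - e * b
    isolate = solve-∀

  ε² : ∀ br → ε br * ε br ≡ 1ℤ
  ε² T₁ = refl
  ε² T₂ = refl

  -- Multiplied by a, the equation of x reads ac + ax (ax + b) = 0. Put z = y + d = e (ax + b); as
  -- e² = 1 this becomes ac + z (z - eb) = 0, and expanding around d gives the claim.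
  affine-root : ∀ {m} a b c d e x y → e * e ≡ 1ℤ →
    m ∣ (y + d) - e * (b + x * a) → m ∣ c + x * (b + x * a) →
    m ∣ (a * c + d * (d - e * b)) + y * (((d + d) - e * b) + y * 1ℤ)
  affine-root a b c d e x y e²≡1 linear root = ∣-respʳ
    (trans (identity a b c e x (y + d)) (trans (cong (λ f → (a * c + (y + d) * ((y + d) - e * b)) + (1ℤ - f) * (x * a * (b + x * a))) e²≡1)
      (recentre d y (e * b) (a * c) (x * a * (b + x * a)))))
    (∣m∣n⇒∣m+n (∣n⇒∣m*n ((y + d) + e * (x * a)) linear) (∣n⇒∣m*n a root))
    where
    identity : ∀ a b c e x z →
      (z + e * (x * a)) * (z - e * (b + x * a)) + a * (c + x * (b + x * a)) ≡
      (a * c + z * (z - e * b)) + (1ℤ - e * e) * (x * a * (b + x * a))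
    identity = solve-∀
    recentre : ∀ d y z q w → (q + (y + d) * ((y + d) - z)) + (1ℤ - 1ℤ) * w ≡
                             (q + d * (d - z)) + y * (((d + d) - z) + y * 1ℤ)
    recentre = solve-∀

  division-root : ∀ {br a b c x y t k d} → Division br a b c x y t k d → ¬ (+ p ∣ b) →
    IsRoot 1ℤ ((+ d + + d) - ε br * b) (a * c + + d * (+ d - ε br * b)) y
  division-root {br} {a} {b} {c} {x} {y} {d = d} div p∤b n =
    affine-root a b c (+ d) (ε br) (approx x n) (approx y n) (ε² br)
      (division-linear div p∤b n) (Division.root div n)

  -- Expansions of rational elements terminate after at most three steps: the
  -- linear coefficient becomes 1, then T₂ leads to 0, and T₁ leads to - p,
  -- which T₂ sends to 0.

  rational-unit : ∀ {b c} (x : Aₚ) → minPoly x ≡ rational b c → ¬ (+ p ∣ b)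
  rational-unit {b} {c} x eq p∣b = p∤1 (IsMinimalPolynomial.coprime isMin (+ p)
    (p∣constant {0ℤ} {b} {c} {element x} (Aₚ.element∈pℤₚ x) (minPoly-root (rational b c) isMin) ∷ p∣b ∷ []))
    where
    isMin = isMinimal x eq

  rational-division : ∀ {br b c x y t k d} → Division br 0ℤ b c x y t k d → ¬ (+ p ∣ b) →
                      IsRoot 0ℤ 1ℤ (+ d - ε br * b) y
  rational-division {br} {b} {c} {x} {y} {d = d} div p∤b n =
    ∣-respʳ (rearrange (approx y n) (approx x n) (+ d) (ε br) b) (division-linear div p∤b n)
    where
    rearrange : ∀ y x d e b → (y + d) - e * (b + x * 0ℤ) ≡ (d - e * b) + y * (1ℤ + y * 0ℤ)
    rearrange = solve-∀

  rational-minPoly : ∀ (y : Aₚ) {c} → IsRoot 0ℤ 1ℤ c (element y) → minPoly y ≡ rational 1ℤ c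
  rational-minPoly y {c} root = identify (minPoly y) refl
    where
    identify : ∀ m → minPoly y ≡ m → minPoly y ≡ rational 1ℤ c
    identify (rational b′ c′) eq =
      let b≡ , c≡ = rational-unique {element y} {b′} {c′} (isMinimal y eq) {c} root in
      trans eq (cong₂ rational b≡ c≡)
    identify (quadratic _ _ _) eq
      with () ← proj₂ (no-linear-relation {element y} (isMinimal y eq) {c} {1ℤ} root)

  rational-step : ∀ {alg t k d b c} (x y : Aₚ) → minPoly x ≡ rational b c → Step alg x t k d y →
                  minPoly y ≡ rational 1ℤ (+ d - ε (branch alg b c) * b)
  rational-step {alg} {b = b} {c} x y eq step = rational-minPoly y
    (rational-division (division x y eq step) (rational-unit x eq))

  -- The element is 0, which is divisible by every power of p and so has no valuation.
  zero-stuck : ∀ {alg t k d} (x y : Aₚ) → minPoly x ≡ rational 1ℤ 0ℤ → ¬ Step alg x t k d y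
  zero-stuck {k = k} x y eq step = proj₂ (Step.valuation step) (∣⇒∈p^ (element x) {suc k} ℕ.≤-refl
    (∣-respʳ (simplify (approx (element x) (suc k))) (minPoly-root (rational 1ℤ 0ℤ) (isMinimal x eq) (suc k))))
    where
    simplify : ∀ x → 0ℤ + x * (1ℤ + x * 0ℤ) ≡ x
    simplify = solve-∀

  rational-constant : ∀ {b c} (x : Aₚ) → minPoly x ≡ rational b c → + p ∣ c
  rational-constant {b} {c} x eq = p∣constant {0ℤ} {b} {c} {element x} (Aₚ.element∈pℤₚ x)
    (minPoly-root (rational b c) (isMinimal x eq))

  T₂-stuck : ∀ {alg t k d t′ k′ d′ c} (x y z : Aₚ) → minPoly x ≡ rational 1ℤ c →
    branch alg 1ℤ c ≡ T₂ → Step alg x t k d y → ¬ Step alg y t′ k′ d′ z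
  T₂-stuck {alg} {d = d} {c = c} x y z eq T₂≡ step = zero-stuck y z
    (trans eq-y (cong (rational 1ℤ) (cong (λ d → + d - 1ℤ * 1ℤ) d≡1)))
    where
    eq-y : minPoly y ≡ rational 1ℤ (+ d - 1ℤ * 1ℤ)
    eq-y = trans (rational-step x y eq step) (cong (λ br → rational 1ℤ (+ d - ε br * 1ℤ)) T₂≡)
    -- The constant coefficient d - 1 of y is divisible by p, and both d and 1 are below p.
    d≡1 : d ≡ 1
    d≡1 = residue-injective (Step.d<p step) 1<p (rational-constant y eq-y)

  branch-1-p : ∀ alg → branch alg 1ℤ (+ p) ≡ T₂
  branch-1-p A = refl
  branch-1-p B = refl
  branch-1-p C = branch-C-T₂ {1ℤ} (+≤+ z≤n) (+<+ (ℕ.<-trans (s≤s z≤n) 1<p))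

  T₁-image : ∀ {alg t k d c} (x y : Aₚ) → minPoly x ≡ rational 1ℤ c →
    branch alg 1ℤ c ≡ T₁ → Step alg x t k d y → minPoly y ≡ rational 1ℤ (+ p)
  T₁-image {d = d} {c = c} x y eq T₁≡ step = trans eq-y (cong (rational 1ℤ) (cong +_ d+1≡p))
    where
    eq-y : minPoly y ≡ rational 1ℤ (+ (d ℕ.+ 1))
    eq-y = trans (rational-step x y eq step) (cong (λ br → rational 1ℤ (+ d - ε br * 1ℤ)) T₁≡)
    -- The constant coefficient d + 1 of y is divisible by p and at most p.
    d+1≡p : d ℕ.+ 1 ≡ p
    d+1≡p = ℕ.≤-antisym (subst (ℕ._≤ p) (ℕ.+-comm 1 d) (Step.d<p step))
      (ℕ.∣⇒≤ {{subst NonZero (ℕ.+-comm 1 d) _}} (∣⇒∣ᵤ (rational-constant y eq-y)))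

  rational-stuck : ∀ {alg b c} (x : ℕ → Aₚ) {t : ℕ → ℤ} {k d : ℕ → ℕ} →
    (∀ i → Step alg (x i) (t i) (k i) (d i) (x (suc i))) → ∀ i → ¬ (minPoly (x i) ≡ rational b c)
  rational-stuck {alg} {b} {c} x {d = d} step i eq = continue (branch alg 1ℤ c′) refl
    where
    c′ = + d i - ε (branch alg b c) * b
    eq₁ : minPoly (x (suc i)) ≡ rational 1ℤ c′
    eq₁ = rational-step (x i) (x (suc i)) eq (step i)
    continue : ∀ br → branch alg 1ℤ c′ ≡ br → ⊥
    continue T₂ T₂≡ = T₂-stuck (x (1 ℕ.+ i)) (x (2 ℕ.+ i)) (x (3 ℕ.+ i)) eq₁ T₂≡ (step (1 ℕ.+ i)) (step (2 ℕ.+ i))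
    continue T₁ T₁≡ = T₂-stuck (x (2 ℕ.+ i)) (x (3 ℕ.+ i)) (x (4 ℕ.+ i))
      (T₁-image (x (1 ℕ.+ i)) (x (2 ℕ.+ i)) eq₁ T₁≡ (step (1 ℕ.+ i)))
      (branch-1-p alg) (step (2 ℕ.+ i)) (step (3 ℕ.+ i))

  -- Contraction and linear fractional maps

  ∣-*-∣ : ∀ {i j k l} → i ∣ j → k ∣ l → i * k ∣ j * l
  ∣-*-∣ {i} {k = k} (divides q refl) (divides r refl) = divides (q * r) (interchange q i r k)
    where
    interchange : ∀ q i r k → (q * i) * (r * k) ≡ (q * r) * (i * k)
    interchange = solve-∀

  -- x = t p^k / (d + y) contracts by a factor p in y.

  contraction : ∀ {alg t k d n} (x x′ y y′ : Aₚ) → Step alg x t k d y → Step alg x′ t k d y′ →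
    p^ n ∣ approx (element y) n - approx (element y′) n →
    p^ (suc n) ∣ approx (element x) (suc n) - approx (element x′) (suc n)
  contraction {t = t} {k} {d} {n} x x′ y y′ step step′ close =
    p^-cancel-unit p∤y+d (suc n) (∣-respʳ (difference X X′ Y Y′ (+ d) (t * p^ k))
      (∣m∣n⇒∣m-n (∣m∣n⇒∣m-n (Step.transformed step (suc n)) (Step.transformed step′ (suc n))) p^∣X′[Y-Y′]))
    where
    X  = approx (element x) (suc n)
    X′ = approx (element x′) (suc n)
    Y  = approx (element y) (suc n)
    Y′ = approx (element y′) (suc n)
    p∤y+d : ¬ (+ p ∣ Y + + d)
    p∤y+d p∣Y+d = p∤small (Step.1≤d step) (Step.d<p step)
      (∣m+n∣m⇒∣n {m = Y} p∣Y+d (p∣approx (element y) (Aₚ.element∈pℤₚ y) n))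
    p^∣Y-Y′ : p^ n ∣ Y - Y′
    p^∣Y-Y′ = ∣-respʳ (telescope Y (approx (element y) n) Y′ (approx (element y′) n))
      (∣m∣n⇒∣m+n (∣m∣n⇒∣m-n (coherent (element y) n) (coherent (element y′) n)) close)
      where
      telescope : ∀ a b c d → ((a - b) - (c - d)) + (b - d) ≡ a - c
      telescope = solve-∀
    p^∣X′[Y-Y′] : p^ (suc n) ∣ X′ * (Y - Y′)
    p^∣X′[Y-Y′] = subst (_∣ X′ * (Y - Y′)) (sym (p^-suc n))
      (∣-*-∣ (p∣approx (element x′) (Aₚ.element∈pℤₚ x′) n) p^∣Y-Y′)
    difference : ∀ x x′ y y′ d w →
      (((y + d) * x - w) - ((y′ + d) * x′ - w)) - x′ * (y - y′) ≡ (y + d) * (x - x′)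
    difference = solve-∀

  -- x i is the image of x (1 + n + i) under a product of matrices
  -- (0 , t p^k ; 1 , d), which is upper triangular with unit lower right
  -- entry modulo p; P , Q ; U , V are the entries.

  record Möbius (x y : ℤₚ) : Set where
    field
      P Q U V  : ℤ
      p∣P      : + p ∣ P
      p∣Q      : + p ∣ Q
      p∤V      : ¬ (+ p ∣ V)
      relation : ∀ m → p^ m ∣ approx x m * (U * approx y m + V) - (P * approx y m + Q)

  p∣tpᵏ : ∀ {alg t k d} (x y : Aₚ) → Step alg x t k d y → + p ∣ t * p^ k
  p∣tpᵏ {t = t} {k} x y step = ∣n⇒∣m*n t (subst (_∣ p^ k) p^1≡p
    (p^∣p^ {1} {k} (positive-valuation {element x} {k} (Aₚ.element∈pℤₚ x) (Step.valuation step))))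

  step-Möbius : ∀ {alg t k d} (x y : Aₚ) → Step alg x t k d y → Möbius (element x) (element y)
  step-Möbius {t = t} {k} {d} x y step = record
    { P = 0ℤ ; Q = t * p^ k ; U = 1ℤ ; V = + d
    ; p∣P = divides 0ℤ refl
    ; p∣Q = p∣tpᵏ x y step
    ; p∤V = p∤small (Step.1≤d step) (Step.d<p step)
    ; relation = λ m → ∣-respʳ
        (rearrange (approx (element x) m) (approx (element y) m) (+ d) (t * p^ k)) (Step.transformed step m)
    }
    where
    rearrange : ∀ x y d w → (y + d) * x - w ≡ x * (1ℤ * y + d) - (0ℤ * y + w)
    rearrange = solve-∀

  Möbius-compose : ∀ {m} P Q U V w x y d T → m ∣ w * (U * x + V) - (P * x + Q) → m ∣ (y + d) * x - T →
                   m ∣ w * (V * y + (U * T + V * d)) - (Q * y + (P * T + Q * d))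
  Möbius-compose P Q U V w x y d T m∣w m∣x = ∣-respʳ (compose P Q U V w x y d T)
    (∣m∣n⇒∣m-n (∣n⇒∣m*n (y + d) m∣w) (∣n⇒∣m*n (w * U - P) m∣x))
    where
    compose : ∀ P Q U V w x y d T →
      (y + d) * (w * (U * x + V) - (P * x + Q)) - (w * U - P) * ((y + d) * x - T) ≡
      w * (V * y + (U * T + V * d)) - (Q * y + (P * T + Q * d))
    compose = solve-∀

  extend-Möbius : ∀ {alg t k d w} (x y : Aₚ) → Möbius w (element x) → Step alg x t k d y →
                  Möbius w (element y)
  extend-Möbius {t = t} {k} {d} {w} x y M step = record
    { P = Q ; Q = P * T + Q * + d ; U = V ; V = U * T + V * + d
    ; p∣P = p∣Q
    ; p∣Q = ∣m∣n⇒∣m+n {m = P * T} {n = Q * + d} (∣m⇒∣m*n T p∣P) (∣m⇒∣m*n (+ d) p∣Q)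
    -- Modulo p the new lower right entry is V d, a product of two units.
    ; p∤V = λ p∣V′ → [ p∤V , p∤small (Step.1≤d step) (Step.d<p step) ]′
        (∣-or-∣ V (+ d) (∣m+n∣m⇒∣n {m = U * T} {n = V * + d} p∣V′ (∣n⇒∣m*n U (p∣tpᵏ x y step))))
    ; relation = λ m → Möbius-compose P Q U V (approx w m) (approx (element x) m) (approx (element y) m) (+ d) T
        (relation m) (Step.transformed step m)
    }
    where
    open Möbius M
    T = t * p^ k

  -- A fixed point of such a product is a root of U X² + (V - P) X - Q.

  Möbius-fixed : ∀ {m} P Q U V x y → m ∣ x * (U * y + V) - (P * y + Q) → m ∣ x - y →
                 m ∣ - Q + x * ((V - P) + x * U)
  Möbius-fixed P Q U V x y m∣x m∣x-y = ∣-respʳ (close P Q U V x y)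
    (∣m∣n⇒∣m+n m∣x (∣n⇒∣m*n (x * U - P) m∣x-y))
    where
    close : ∀ P Q U V x y → (x * (U * y + V) - (P * y + Q)) + (x * U - P) * (x - y) ≡
                            - Q + x * ((V - P) + x * U)
    close = solve-∀

  -- Comparison of the minimal polynomial with U X² + (V - P) X - Q gives a (V - P) = U b, where V -
  -- P is a unit. So p ∣ b would imply p ∣ a, and p ∣ c holds anyway, against coprimality.
  Möbius-unit : ∀ {a b c} {x y : ℤₚ} → Möbius x y → x ∈p^ 1 → x ≈ y →
                IsMinimalPolynomial x (quadratic a b c) → ¬ (+ p ∣ b)
  Möbius-unit {a} {b} {c} {x} {y} M x∈p x≈y isMin p∣b =
    p∤1 (IsMinimalPolynomial.coprime isMin (+ p)
      (p∣constant {a} {b} {c} {x} x∈p (minPoly-root (quadratic a b c) isMin) ∷ p∣b ∷ p∣a ∷ []))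
    where
    open Möbius M
    root : IsRoot U (V - P) (- Q) x
    root m = Möbius-fixed P Q U V (approx x m) (approx y m) (relation m) (x≈y m)
    p∤V-P : ¬ (+ p ∣ V - P)
    p∤V-P p∣V-P = p∤V (∣-transfer {+ p} {V} {P} p∣V-P p∣P)
    a[V-P]≡Rb : a * (V - P) ≡ U * b
    a[V-P]≡Rb = proj₂ (quadratic-proportional {x} isMin {U} {V - P} { - Q} root)
    p∣a : + p ∣ a
    p∣a = [ (λ p∣a → p∣a) , (λ p∣V-P → contradiction p∣V-P p∤V-P) ]′
      (∣-or-∣ a (V - P) (subst (+ p ∣_) (sym a[V-P]≡Rb) (∣n⇒∣m*n U p∣b)))

  relabel : ∀ {alg x y t t′ k k′ d d′} → t ≡ t′ → k ≡ k′ → d ≡ d′ →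
            Step alg x t k d y → Step alg x t′ k′ d′ y
  relabel refl refl refl step = step

  IsRoot-resp : ∀ {a b c x y} → x ≈ y → IsRoot a b c x → IsRoot a b c y
  IsRoot-resp {a} {b} {c} {x} {y} x≈y root n = ∣-respʳ (difference a b c (approx x n) (approx y n))
    (∣m∣n⇒∣m-n (root n) (∣m⇒∣m*n (b + a * (approx x n + approx y n)) (x≈y n)))
    where
    difference : ∀ a b c x y →
      (c + x * (b + x * a)) - (x - y) * (b + a * (x + y)) ≡ c + y * (b + y * a)
    difference = solve-∀

  -- Orbits with periodic data

  module Orbit {alg : Algorithm} (x : ℕ → Aₚ) (t : ℕ → ℤ) (k d : ℕ → ℕ)
           (step : ∀ i → Step alg (x i) (t i) (k i) (d i) (x (suc i)))
           (ℓ-1 : ℕ)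
           (periodic : ∀ i → t (i ℕ.+ suc ℓ-1) ≡ t i × k (i ℕ.+ suc ℓ-1) ≡ k i × d (i ℕ.+ suc ℓ-1) ≡ d i)
           where

    ℓ : ℕ
    ℓ = suc ℓ-1

    -- Periodicity of t, k, d passes to the elements: the two sides have the same data from here on,
    -- and each step back along the orbit gains one digit of agreement.
    returns : ∀ i → element (x (i ℕ.+ ℓ)) ≈ element (x i)
    returns i zero    = p^0∣ _
    returns i (suc n) = contraction (x (i ℕ.+ ℓ)) (x i) (x (suc i ℕ.+ ℓ)) (x (suc i))
      (relabel (proj₁ (periodic i)) (proj₁ (proj₂ (periodic i))) (proj₂ (proj₂ (periodic i))) (step (i ℕ.+ ℓ)))
      (step i) (returns (suc i) n)

    möbius : ∀ i n → Möbius (element (x i)) (element (x (suc n ℕ.+ i)))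
    möbius i zero    = step-Möbius (x i) (x (suc i)) (step i)
    möbius i (suc n) = extend-Möbius (x (suc n ℕ.+ i)) (x (suc (suc n) ℕ.+ i)) (möbius i n) (step (suc n ℕ.+ i))

    quadratic-at : ∀ i → Σ[ (a , b , c) ∈ ℤ × ℤ × ℤ ] minPoly (x i) ≡ quadratic a b c
    quadratic-at i = identify (minPoly (x i)) refl
      where
      identify : ∀ m → minPoly (x i) ≡ m → Σ[ (a , b , c) ∈ ℤ × ℤ × ℤ ] minPoly (x i) ≡ quadratic a b c
      identify (quadratic a b c) eq = (a , b , c) , eq
      identify (rational b c)    eq = contradiction eq (rational-stuck x step i)

    a b c : ℕ → ℤ
    a i = proj₁ (proj₁ (quadratic-at i))
    b i = proj₁ (proj₂ (proj₁ (quadratic-at i)))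
    c i = proj₂ (proj₂ (proj₁ (quadratic-at i)))

    minimal : ∀ i → IsMinimalPolynomial (element (x i)) (quadratic (a i) (b i) (c i))
    minimal i = isMinimal (x i) (proj₂ (quadratic-at i))

    unit : ∀ i → ¬ (+ p ∣ b i)
    unit i = Möbius-unit {a i} {b i} {c i} (möbius i ℓ-1) (Aₚ.element∈pℤₚ (x i))
      (λ n → ∣-swap (approx (element (x (ℓ ℕ.+ i))) n) (approx (element (x i)) n)
        (subst (λ j → p^ n ∣ approx (element (x j)) n - approx (element (x i)) n) (ℕ.+-comm i ℓ) (returns i n)))
      (minimal i)

    divide : ∀ i → Division (branch alg (b i) (c i)) (a i) (b i) (c i)
                            (element (x i)) (element (x (suc i))) (t i) (k i) (d i)
    divide i = division (x i) (x (suc i)) (proj₂ (quadratic-at i)) (step i)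

    successor : ∀ i → let z = ε (branch alg (b i) (c i)) * b i in
      a (suc i) ≡ 1ℤ × b (suc i) ≡ (+ d i + + d i) - z × c (suc i) ≡ a i * c i + + d i * (+ d i - z)
    successor i = monic-unique (minimal (suc i)) (division-root (divide i) (unit i))

    -- The element at index 0 is not given as an image under T, but it equals the one at index ℓ ≥
    -- 1, which is. The monic polynomial found there serves for both.
    first : a 0 ≡ 1ℤ × b 0 ≡ b ℓ × c 0 ≡ c ℓ
    first = monic-unique (minimal 0) {b ℓ} {c ℓ} (IsRoot-resp {1ℤ} {b ℓ} {c ℓ} {element (x ℓ)} {element (x 0)} (returns 0)
      (subst (λ a → IsRoot a (b ℓ) (c ℓ) (element (x ℓ))) (proj₁ (successor ℓ-1))
        (minPoly-root (quadratic (a ℓ) (b ℓ) (c ℓ)) (minimal ℓ))))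

    monic : ∀ i → a i ≡ 1ℤ
    monic zero    = proj₁ first
    monic (suc i) = proj₁ (successor i)

    state : ℕ → ℤ × ℤ
    state i = b i , c i

    move-digit : ∀ {z d a c b′ c′} → z mod ≡ d → a ≡ 1ℤ → b′ ≡ (d + d) - z → c′ ≡ a * c + d * (d - z) →
                 (b′ , c′) ≡ move z c
    move-digit {z} {c = c} refl refl refl refl =
      cong (λ c → (z mod + z mod) - z , c + z mod * (z mod - z)) (ℤ.*-identityˡ c)

    state-next : ∀ i → state (suc i) ≡ next alg (state i)
    state-next i = move-digit {β alg (state i)} {+ d i} {a i} {c i} {b (suc i)} {c (suc i)}
      (division-digit (divide i) (unit i)) (monic i)
      (proj₁ (proj₂ (successor i))) (proj₂ (proj₂ (successor i)))

    state-trajectory : ∀ i → trajectory alg (state 0) i ≡ state i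
    state-trajectory zero    = refl
    state-trajectory (suc i) = trans (cong (next alg) (state-trajectory i)) (sym (state-next i))

    state-periodic : Periodic alg (state 0)
    state-periodic = ℓ , s≤s z≤n , trans (state-trajectory ℓ) (sym (cong₂ _,_ (proj₁ (proj₂ first)) (proj₂ (proj₂ first))))

    state-minimal : IsMinimalPolynomial (element (x 0)) (quadratic 1ℤ (b 0) (c 0))
    state-minimal = subst (λ a → IsMinimalPolynomial (element (x 0)) (quadratic a (b 0) (c 0))) (monic 0) (minimal 0)

    state-root : IsRoot 1ℤ (b 0) (c 0) (element (x 0))
    state-root = minPoly-root (quadratic 1ℤ (b 0) (c 0)) state-minimal

    state-Hensel : Hensel (state 0)
    state-Hensel = hensel (unit 0)
      (p∣constant {1ℤ} {b 0} {c 0} {element (x 0)} (Aₚ.element∈pℤₚ (x 0)) state-root)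
      (minimal⇒noRoot (Aₚ.element∈pℤₚ (x 0)) (unit 0) state-minimal)

  PeriodicRoots : Algorithm → Pred (ℤ × ℤ) 0ℓ
  PeriodicRoots alg s = Hensel s × Periodic alg s

  reduced⇒periodic : ∀ alg {α} → PurelyPeriodic alg α → HenselRoots (PeriodicRoots alg) α
  reduced⇒periodic alg {y /p^ m} record
    { expansion = record { orbit = x ; t = t ; k = k ; d = d ; start = start ; step = step }
    ; integralPart = integralPart ; ℓ = suc ℓ-1 ; periodic = periodic } =
    state 0 , (state-Hensel , state-periodic) , element (x 0) , same , Aₚ.element∈pℤₚ (x 0) ,
    quadratic-eval {1ℤ} {b 0} {c 0} {element (x 0)} state-root
    where
    open Orbit x t k d step ℓ-1 periodic hiding (ℓ)
    σ = + Σdigits y (suc m)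
    simplify₁ : ∀ s q → 1ℤ * s - q * 0ℤ ≡ s
    simplify₁ = solve-∀
    simplify₂ : ∀ w y → w - 1ℤ * (y + - 1ℤ * 0ℤ) ≡ w - 1ℤ * y
    simplify₂ = solve-∀
    -- The integral part is σ / pᵐ with an integer σ, and an integer that is 0 in ℤₚ is 0. Hence α
    -- equals its fractional part, where the orbit starts.
    σ≡0 : σ ≡ 0ℤ
    σ≡0 = p^∣⇒≡0 λ n → ∣-respʳ (simplify₁ σ (p^ m)) (integralPart n)
    same : ι (element (x 0)) ≈ℚ (y /p^ m)
    same n = ∣-respʳ (simplify₂ (p^ m * approx (element (x 0)) n) (approx y n))
      (subst (λ s → p^ n ∣ p^ m * approx (element (x 0)) n - 1ℤ * (approx y n + - 1ℤ * s)) σ≡0 (start n))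

  -- From coefficients to expansions

  record Root (s : ℤ × ℤ) : Set where
    field
      x    : ℤₚ
      x∈p  : x ∈p^ 1
      root : IsRoot 1ℤ (proj₁ s) (proj₂ s) x

  -- As x x̄ = c and x + x̄ = - b, the quotient - ε c / x is ε (b + x).

  next-root : ∀ alg s → Root s → Root (next alg s)
  next-root alg (b , c) r = record
    { x    = y
    ; x∈p  = ∣⇒∈p^ y {1} ℕ.≤-refl (p∣⇒p^1∣ (∣m∣n⇒∣m+n {m = e * approx x 1} {n = z - z mod}
               (∣n⇒∣m*n e (p∣approx x x∈p 0)) (p∣z-z%p z)))
    ; root = λ n → subst (λ f → p^ n ∣ (f + z mod * (z mod - z)) + approx y n * (((z mod + z mod) - z) + approx y n * 1ℤ))
        (ℤ.*-identityˡ c)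
        (affine-root 1ℤ b c (z mod) e (approx x n) (approx y n) (ε² (branch alg b c))
          (divides 0ℤ (cancel b e (z mod) (approx x n))) (root n))
    }
    where
    open Root r
    e = ε (branch alg b c)
    z = e * b
    y : ℤₚ
    y = ⟪ e ⟫ ⊗ x ⊕ ⟪ z - z mod ⟫
    cancel : ∀ b e d x → ((e * x + (e * b - d)) + d) - e * (b + x * 1ℤ) ≡ 0ℤ
    cancel = solve-∀

  toAₚ : ∀ s → Hensel s → Root s → Aₚ
  toAₚ (b , c) h r = record
    { element             = x
    ; element∈pℤₚ         = x∈p
    ; minPoly             = quadratic 1ℤ b c
    ; isMinimalPolynomial = noRoot⇒minimal x∈p (p∤b h) (noRoot h) root
    }
    where open Root r

  -- The first argument is fuel. The value |c| suffices, since every division by p makes a non-zero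
  -- integer smaller in absolute value.
  unitPart : ℕ → ℤ → ℤ × ℕ
  unitPart zero    c = c , 0
  unitPart (suc f) c with + p ∣? c
  ... | yes (divides q _) = let u , j = unitPart f q in u , suc j
  ... | no  _             = c , 0

  unitPart-correct : ∀ f {c} → c ≢ 0ℤ → abs c ℕ.≤ f →
                     c ≡ proj₁ (unitPart f c) * p^ (proj₂ (unitPart f c)) × ¬ (+ p ∣ proj₁ (unitPart f c))
  unitPart-correct zero    {c} c≢0 ∣c∣≤0 = contradiction (ℤ.∣i∣≡0⇒i≡0 (ℕ.n≤0⇒n≡0 ∣c∣≤0)) c≢0
  unitPart-correct (suc f) {c} c≢0 ∣c∣≤f with + p ∣? c
  ... | no p∤c = sym (ℤ.*-identityʳ c) , p∤c
  ... | yes (divides q c≡qp) = trans c≡qp (trans (cong (_* + p) (proj₁ correct))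
      (trans (rearrange (proj₁ (unitPart f q)) (p^ j) (+ p))
             (cong (proj₁ (unitPart f q) *_) (sym (p^-suc j))))) , proj₂ correct
    where
    j = proj₂ (unitPart f q)
    rearrange : ∀ u r p → (u * r) * p ≡ u * (p * r)
    rearrange = solve-∀
    q≢0 : q ≢ 0ℤ
    q≢0 q≡0 = c≢0 (trans c≡qp (cong (_* + p) q≡0))
    ∣q∣<∣c∣ : abs q ℕ.< abs c
    ∣q∣<∣c∣ = subst (abs q ℕ.<_) (sym (trans (cong abs c≡qp) (ℤ.abs-* q (+ p))))
      (ℕ.m<m*n (abs q) p {{ℤ.≢-nonZero q≢0}} 1<p)
    correct = unitPart-correct f q≢0 (ℕ.≤-pred (ℕ.≤-trans ∣q∣<∣c∣ ∣c∣≤f))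

  u-of : ℤ → ℤ
  u-of c = proj₁ (unitPart (abs c) c)

  k-of : ℤ → ℕ
  k-of c = proj₂ (unitPart (abs c) c)

  -- In c = - x (b + x) the second factor is a unit, so the exact power of p in c is passed on to x.
  root-valuation : ∀ {b c x u j} → x ∈p^ 1 → ¬ (+ p ∣ b) → IsRoot 1ℤ b c x →
                   c ≡ u * p^ j → ¬ (+ p ∣ u) → HasValuation x j
  root-valuation {b} {c} {x} {u} {j} x∈p p∤b root c≡upʲ p∤u = ∣⇒∈p^ x {j} ℕ.≤-refl (pʲ∣x j p^∣c (root j)) , x∉
    where
    p^∣c : p^ j ∣ c
    p^∣c = divides u c≡upʲ
    pʲ∣x : ∀ i → p^ i ∣ c → p^ i ∣ c + approx x i * (b + approx x i * 1ℤ) → p^ i ∣ approx x i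
    pʲ∣x zero    _    _    = p^0∣ (approx x 0)
    pʲ∣x (suc i) p^∣c p^∣f = p^-cancel-unit {b + approx x (suc i) * 1ℤ}
      (λ p∣b+x → p∤b (∣m+n∣n⇒∣m {m = b} p∣b+x (∣m⇒∣m*n 1ℤ (p∣approx x x∈p i)))) (suc i)
      (∣-respʳ (ℤ.*-comm (approx x (suc i)) (b + approx x (suc i) * 1ℤ))
        (∣m+n∣m⇒∣n {m = c} p^∣f p^∣c))
    x∉ : ¬ (x ∈p^ suc j)
    x∉ x∈ = p∤u (*-cancelˡ-∣ (p^ j) {{p^-nonZero j}} (subst₂ _∣_
      (trans (p^-suc j) (ℤ.*-comm (+ p) (p^ j))) (trans c≡upʲ (ℤ.*-comm u (p^ j)))
      (∣m+n∣n⇒∣m {m = c} (root (suc j))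
        (∣m⇒∣m*n (b + approx x (suc j) * 1ℤ) (∈p^⇒∣ {x} x∈ ℕ.≤-refl)))))

  -- For y + d = ε (b + x) the product (y + d) x differs from - ε c by ε times the equation of x,
  -- which gives the cleared form of T(x) directly.
  root-step : ∀ alg s (h : Hensel s) (r : Root s) (h′ : Hensel (next alg s)) →
    Step alg (toAₚ s h r) (signed (branch alg (proj₁ s) (proj₂ s)) (u-of (proj₂ s))) (k-of (proj₂ s))
         (β alg s %ℕ p) (toAₚ (next alg s) h′ (next-root alg s r))
  root-step alg s@(b , c) h r h′ = record
    { u           = u-of c
    ; isUnitPart  = k-of c , correct
    ; numerator   = refl
    ; valuation   = root-valuation {b} {c} {x} {u-of c} {k-of c} x∈p (p∤b h) root (proj₁ correct) (proj₂ correct)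
    ; 1≤d         = 1≤%p (β alg s) (p∤ε* (branch alg b c) (p∤b h))
    ; d<p         = n%ℕd<d (β alg s) p
    ; transformed = λ n → quotient-equation n (branch alg b c) (+ (β alg s %ℕ p))
    }
    where
    open Root r
    correct = unitPart-correct (abs c) (NoRoot⇒c≢0 (noRoot h)) ℕ.≤-refl
    numerator-ε : ∀ br → signed br (u-of c) * p^ (k-of c) ≡ - (ε br * c)
    numerator-ε br = trans (cong (_* p^ (k-of c)) (signed-ε br (u-of c)))
      (trans (assoc (ε br) (u-of c) (p^ (k-of c))) (cong (λ c → - (ε br * c)) (sym (proj₁ correct))))
      where
      assoc : ∀ e u q → - (e * u) * q ≡ - (e * (u * q))
      assoc = solve-∀
    scale : ∀ b c e d x → e * (c + x * (b + x * 1ℤ)) ≡ ((e * x + (e * b - d)) + d) * x - - (e * c)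
    scale = solve-∀
    quotient-equation : ∀ n br d →
      p^ n ∣ ((ε br * approx x n + (ε br * b - d)) + d) * approx x n - signed br (u-of c) * p^ (k-of c)
    quotient-equation n br d = subst
      (λ w → p^ n ∣ ((ε br * approx x n + (ε br * b - d)) + d) * approx x n - w) (sym (numerator-ε br))
      (∣-respʳ (scale b c (ε br) d (approx x n)) (∣n⇒∣m*n (ε br) (root n)))

  -- Digits and the vanishing integral part

  ∣⇒%≡0 : ∀ n .{{_ : NonZero n}} {z} → + n ∣ z → z %ℕ n ≡ 0
  ∣⇒%≡0 n {z} n∣z = m∣n∧n<m⇒n≡0 (∣⇒∣ᵤ (∣m+n∣n⇒∣m {m = + (z %ℕ n)}
    (∣-respʳ (a≡a%ℕn+[a/ℕn]*n z n) n∣z) (∣n⇒∣m*n (z /ℕ n) ∣-refl))) (n%ℕd<d z n)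

  digit-zero : ∀ y i → p^ (suc i) ∣ approx y (suc i) → digit y i ≡ 0
  digit-zero y i p^∣y = trans
    (cong (λ r → (r ℕ./ p ℕ.^ i) {{ℕ.m^n≢0 p i}}) (∣⇒%≡0 (p ℕ.^ suc i) {{ℕ.m^n≢0 p (suc i)}} p^∣y))
    (ℕ.0/n≡0 (p ℕ.^ i) {{ℕ.m^n≢0 p i}})

  Σdigits-zero : ∀ y n → (∀ i → i ℕ.< n → p^ (suc i) ∣ approx y (suc i)) → Σdigits y n ≡ 0
  Σdigits-zero y zero    _    = refl
  Σdigits-zero y (suc n) p^∣y = cong₂ ℕ._+_ (Σdigits-zero y n (λ i i<n → p^∣y i (ℕ.m≤n⇒m≤1+n i<n)))
    (cong (ℕ._* p ℕ.^ n) (digit-zero y n (p^∣y n ℕ.≤-refl)))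

  -- The numerator p^m x has no digits below p^(m + 1).

  integral-digits : ∀ {x y m} → x ∈p^ 1 → ι x ≈ℚ (y /p^ m) → Σdigits y (suc m) ≡ 0
  integral-digits {x} {y} {m} x∈p same = Σdigits-zero y (suc m) λ i i≤m →
    ∣-transfer (∣-swap (p^ m * approx x (suc i)) (approx y (suc i))
      (∣-respʳ (cong (_-_ (p^ m * approx x (suc i))) (ℤ.*-identityˡ (approx y (suc i)))) (same (suc i))))
      (∣-trans (p^∣p^ i≤m) (subst (_∣ p^ m * approx x (suc i)) (trans (ℤ.*-comm (p^ m) (+ p)) (sym (p^-suc m)))
        (*-monoʳ-∣ (p^ m) (p∣approx x x∈p i))))

  periodic⇒reduced : ∀ alg {α} → HenselRoots (PeriodicRoots alg) α → PurelyPeriodic alg α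
  periodic⇒reduced alg {y /p^ m} (s@(b , c) , (h , ℓ , 1≤ℓ , cycle) , x , same , x∈p , root) = record
    { expansion = record
      { orbit = λ i → toAₚ (state i) (hensel-at i) (root-at i)
      ; t     = λ i → t-of (state i)
      ; k     = λ i → k-of (proj₂ (state i))
      ; d     = λ i → β alg (state i) %ℕ p
      ; start = λ n → subst (λ σ → p^ n ∣ p^ m * approx x n - 1ℤ * (approx y n + - 1ℤ * + σ)) (sym σ≡0)
          (∣-respʳ (simplify₂ (p^ m * approx x n) (approx y n)) (same n))
      ; step  = λ i → root-step alg (state i) (hensel-at i) (root-at i) (hensel-at (suc i))
      }
    ; integralPart = λ n → subst (λ σ → p^ n ∣ 1ℤ * + σ - p^ m * 0ℤ) (sym σ≡0)
        (divides 0ℤ (simplify₁ (p^ m)))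
    ; ℓ        = ℓ
    ; 1≤ℓ      = 1≤ℓ
    -- The data are functions of the state, so they inherit its period.
    ; periodic = λ i → let s≡ = trajectory-periodic alg cycle i in
        cong t-of s≡ , cong (λ s → k-of (proj₂ s)) s≡ , cong (λ s → β alg s %ℕ p) s≡
    }
    where
    state : ℕ → ℤ × ℤ
    state = trajectory alg s
    hensel-at : ∀ i → Hensel (state i)
    hensel-at = trajectory-Hensel alg h
    root-at : ∀ i → Root (state i)
    root-at zero    = record { x = x ; x∈p = x∈p ; root = eval-quadratic {1ℤ} {b} {c} {x} root }
    root-at (suc i) = next-root alg (state i) (root-at i)
    t-of : ℤ × ℤ → ℤ
    t-of (b , c) = signed (branch alg b c) (u-of c)
    σ≡0 : Σdigits y (suc m) ≡ 0
    σ≡0 = integral-digits {x} {y} {m} x∈p same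
    simplify₁ : ∀ q → 1ℤ * 0ℤ - q * 0ℤ ≡ 0ℤ
    simplify₁ = solve-∀
    simplify₂ : ∀ w y → w - 1ℤ * y ≡ w - 1ℤ * (y + - 1ℤ * 0ℤ)
    simplify₂ = solve-∀

  -- Identification of the reduced sets

  reduced-≐ : ∀ alg {P : Pred (ℤ × ℤ) 0ℓ} → PeriodicRoots alg ≐ P → Reduced alg ≐ HenselRoots P
  reduced-≐ alg (to , from) =
    (λ r → let s , w , x = reduced⇒periodic alg r in s , to w , x) ,
    (λ (s , w , x) → periodic⇒reduced alg (s , from w , x))

  Hensel⇒S : ∀ {s} → Hensel s → S s
  Hensel⇒S h = p∤b h , p∣c h , noRoot⇒irreducible (noRoot h)

  S⇒Hensel : ∀ {s} → S s → Hensel s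
  S⇒Hensel (p∤b , p∣c , irreducible) = hensel p∤b p∣c (irreducible⇒noRoot irreducible)

  0<⇒1≤ : ∀ {i} → 0ℤ < i → 1ℤ ≤ i
  0<⇒1≤ = ℤ.i<j⇒suc[i]≤j

  1≤⇒0< : ∀ {i} → 1ℤ ≤ i → 0ℤ < i
  1≤⇒0< = ℤ.suc[i]≤j⇒i<j

  <⇒≤p-1 : ∀ {i} → i < + p → i ≤ + p - 1ℤ
  <⇒≤p-1 {i} i<p = subst (i ≤_) (ℤ.+-comm (- 1ℤ) (+ p)) (ℤ.i<j⇒i≤pred[j] i<p)

  ≤p-1⇒< : ∀ {i} → i ≤ + p - 1ℤ → i < + p
  ≤p-1⇒< {i} i≤p-1 = ℤ.i≤pred[j]⇒i<j (subst (i ≤_) (ℤ.+-comm (+ p) (- 1ℤ)) i≤p-1)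

  A-periodic-≐ : PeriodicRoots A ≐ S
  A-periodic-≐ = (λ (h , _) → Hensel⇒S h) , (λ {s} w → S⇒Hensel w , A-periodic s)

  B-periodic-≐ : PeriodicRoots B ≐ R
  B-periodic-≐ = to , from
    where
    to : ∀ {s} → PeriodicRoots B s → R s
    to (h , periodic) = let 0<b , b<p = B-periodic⇒small h periodic in
      Hensel⇒S h , 0<⇒1≤ 0<b , <⇒≤p-1 b<p
    from : ∀ {s} → R s → PeriodicRoots B s
    from {s} (w , 1≤b , b≤p-1) = S⇒Hensel w , small⇒B-periodic {s} (1≤⇒0< 1≤b , ≤p-1⇒< b≤p-1)

  C-periodic-≐ : PeriodicRoots C ≐ P₁ ∪ R₁ ∪ S₃ ∪ S₄
  C-periodic-≐ = (λ (h , periodic) → to h (C-periodic⇒target h periodic)) , from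
    where
    to : ∀ {s} → Hensel s → Target s → (P₁ ∪ R₁ ∪ S₃ ∪ S₄) s
    to {b , c} h (negative c<0) with ℤ.<-cmp b 0ℤ
    ... | tri< b<0 _ _ = inj₂ (inj₂ (inj₁ (Hensel⇒S h , b<0 , c<0)))
    ... | tri≈ _ b≡0 _ = contradiction b≡0 (p∤⇒≢0 (p∤b h))
    ... | tri> _ _ 0<b = inj₂ (inj₂ (inj₂ (Hensel⇒S h , 0<b , c<0)))
    to h (small 0<c 0<b b<p) = inj₂ (inj₁ ((Hensel⇒S h , 0<b , 0<c) , 0<⇒1≤ 0<b , <⇒≤p-1 b<p))
    to h (big 0<c 0<b p≤b c<) = inj₁ ((Hensel⇒S h , 0<b , 0<c) ,
      (λ (_ , _ , b≤p-1) → ℤ.<⇒≱ (≤p-1⇒< b≤p-1) p≤b) , c<)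

    from : ∀ {s} → (P₁ ∪ R₁ ∪ S₃ ∪ S₄) s → PeriodicRoots C s
    from w = let h , target = split w in h , target⇒C-periodic h target
      where
      split : ∀ {s} → (P₁ ∪ R₁ ∪ S₃ ∪ S₄) s → Hensel s × Target s
      split {b , c} (inj₁ (s₁@(w , 0<b , 0<c) , ∉R₁ , c<)) = S⇒Hensel w ,
        -- Within `S₁`, lying outside `R₁` means p ≤ b.
        big 0<c 0<b (ℤ.≮⇒≥ λ b<p → ∉R₁ (s₁ , 0<⇒1≤ 0<b , <⇒≤p-1 b<p)) c<
      split (inj₂ (inj₁ ((w , 0<b , 0<c) , _ , b≤p-1))) = S⇒Hensel w , small 0<c 0<b (≤p-1⇒< b≤p-1)
      split (inj₂ (inj₂ (inj₁ (w , _ , c<0)))) = S⇒Hensel w , negative c<0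
      split (inj₂ (inj₂ (inj₂ (w , _ , c<0)))) = S⇒Hensel w , negative c<0

theorem7p2 : (p : ℕ) (p-prime : Prime p) →
    let open Expansions p p-prime in
    (Reduced A ≐ HenselRoots S)
    × (Reduced B ≐ HenselRoots R)
    × (Reduced C ≐ HenselRoots (P₁ ∪ R₁ ∪ S₃ ∪ S₄))
theorem7p2 p p-prime =
  reduced-≐ A A-periodic-≐ , reduced-≐ B B-periodic-≐ , reduced-≐ C C-periodic-≐
  where open ReducedSets p p-prime
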